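{- In the locker room problem with $n$ lockers, with the sought number $s$ chosen uniformly at random from $\{0,\dots,n-1\}$ independently of the placement of the cards, the optimal (maximum over all strategies of Alice and Bob) probability $\Pr[\mathcal V(\mathrm{CLR})]$ that Bob finds card $s$ satisfies $$\Pr[\mathcal V(\mathrm{CLR})]\le\frac{(4+o(1))\,\log n}{n\,\log\log n},$$ where $o(1)$ denotes a quantity depending only on $n$ and tending to $0$ as $n\to\infty$.
   Context: $\log=\log_2$. Locker room problem (CLR protocol): there are $n$ lockers numbered $0,\dots,n-1$, into which $n$ cards numbered $0,\dots,n-1$ are placed, one per locker, according to a uniformly random permutation $\sigma$ (locker $\ell$ contains card $\sigma(\ell)$). Alice sees the contents of all lockers and may then swap the cards of one pair of lockers, or leave everything unchanged; she does not know $s$. Then Bob, who does not know $\sigma$, is given $s\in\{0,\dots,n-1\}$ and may open at most two lockers, the choice of the second being allowed to depend on $s$ and on the card seen in the first. Bob succeeds if one of the opened lockers contains card $s$. Alice and Bob agree on a strategy (Alice's swap as a function of $\sigma$; Bob's first locker as a function of $s$; Bob's second locker as a function of $s$ and the card seen in the first locker) beforehand. -}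

module Defs where

open import Algebra.Definitions.RawSemiring using (_^_)
open import Data.Fin.Base using (Fin)
open import Data.Fin.Permutation.Components using (transpose)
open import Data.Fin.Properties using (_≟_)
open import Data.Integer.Base using (ℤ; +_; -[1+_])
open import Data.List.Base using (List; []; _∷_; length; filter; allFin; cartesianProduct; cartesianProductWith)
open import Data.List.Membership.Propositional using (_∈_)
open import Data.List.Membership.Propositional.Properties
  using (∈-cartesianProduct⁺; ∈-cartesianProductWith⁺; ∈-filter⁺; ∈-allFin; ∈-length)
open import Data.List.Relation.Unary.Any using (here)
open import Data.Nat.Base as ℕ using (ℕ; zero; suc; NonZero; >-nonZero)
open import Data.Product.Base using (_×_; _,_; ∃-syntax)
open import Data.Rational.Base using (ℚ; _*_; _<_; _⊓_; _⊔_; _/_; 0ℚ; 1ℚ; ½; ∣_∣; ↥_; ↧ₙ_; +-*-rawSemiring)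
open import Data.Sum.Base using (_⊎_)
open import Data.Vec.Base using (Vec; []; _∷_; lookup; tabulate)
open import Data.Vec.Relation.Unary.AllPairs using (allPairs?)
open import Data.Vec.Relation.Unary.Unique.Propositional using (Unique)
open import Data.Vec.Relation.Unary.Unique.Propositional.Properties using (tabulate⁺)
open import Function.Base using (id)
open import Relation.Binary.PropositionalEquality.Core using (_≡_; refl)
open import Relation.Nullary using (¬_)
open import Relation.Nullary.Decidable using (¬?; _⊎-dec_)
open import Relation.Unary using (Decidable)

infix  8 _⁻¹
infixl 7 _·_ _÷_
infix  4 _≤ᴿ_ _<ᴿ_

fromℕ : ℕ → ℚ
fromℕ k = + k / 1

-- A real number is represented by its Dedekind cut: lower x q means q < x
-- and upper x q means x < q.  The cut axioms are not part of the record,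
-- since the reals below are all built explicitly and never quantified over.

record Cut : Set₁ where
  field
    lower : ℚ → Set
    upper : ℚ → Set

open Cut public

_<ᴿ_ : Cut → Cut → Set
x <ᴿ y = ∃[ q ] upper x q × lower y q

_≤ᴿ_ : Cut → Cut → Set
x ≤ᴿ y = ¬ (y <ᴿ x)

real : ℚ → Cut
real r .lower q = q < r
real r .upper q = r < q

-- Interval multiplication: from a < x < b and c < y < d, the product xy lies
-- between the least and the greatest of the four corner products.

_·_ : Cut → Cut → Cut
(x · y) .lower q =
  ∃[ a ] ∃[ b ] ∃[ c ] ∃[ d ]
    lower x a × upper x b × lower y c × upper y d ×
    q < ((a * c) ⊓ (a * d)) ⊓ ((b * c) ⊓ (b * d))
(x · y) .upper q =
  ∃[ a ] ∃[ b ] ∃[ c ] ∃[ d ]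
    lower x a × upper x b × lower y c × upper y d ×
    ((a * c) ⊔ (a * d)) ⊔ ((b * c) ⊔ (b * d)) < q

-- Meaningful for positive reals only.

_⁻¹ : Cut → Cut
(x ⁻¹) .lower q = ∃[ b ] 0ℚ < b × upper x b × q * b < 1ℚ
(x ⁻¹) .upper q = ∃[ a ] 0ℚ < a × lower x a × 1ℚ < q * a

_÷_ : Cut → Cut → Cut
x ÷ y = x · y ⁻¹

pow : ℚ → ℕ → ℚ
pow = _^_ +-*-rawSemiring

2^ : ℤ → ℚ
2^ (+ k)    = pow (fromℕ 2) k
2^ -[1+ k ] = pow ½ (suc k)

-- Meaningful for positive reals only.  With q = p/r and r > 0, the relation
-- q < log₂ x says 2^p < x^r, that is, 2^p < s^r for some rational 0 < s < x.

log₂ : Cut → Cut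
log₂ x .lower q = ∃[ s ] 0ℚ < s × lower x s × 2^ (↥ q) < pow s (↧ₙ q)
log₂ x .upper q = ∃[ s ] 0ℚ < s × upper x s × pow s (↧ₙ q) < 2^ (↥ q)

TendsToZero : (ℕ → ℚ) → Set
TendsToZero δ = ∀ ε → 0ℚ < ε → ∃[ N ] ∀ n → N ℕ.≤ n → ∣ δ n ∣ < ε

-- The probability of P under the uniform distribution on the entries of Ω.

Pr : {A : Set} (Ω : List A) .{{_ : NonZero (length Ω)}} {P : A → Set} → Decidable P → ℚ
Pr Ω P? = + length (filter P? Ω) / length Ω

-- The entry at position ℓ is the card in locker ℓ.

Contents : ℕ → Set
Contents n = Vec (Fin n) n

allVecs : ∀ n m → List (Vec (Fin n) m)
allVecs n zero    = [] ∷ []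
allVecs n (suc m) = cartesianProductWith _∷_ (allFin n) (allVecs n m)

unique? : ∀ {n m} → Decidable (Unique {A = Fin n} {m})
unique? = allPairs? (λ i j → ¬? (i ≟ j))

permutations : ∀ n → List (Contents n)
permutations n = filter unique? (allVecs n n)

Outcomes : ∀ n → List (Contents n × Fin n)
Outcomes n = cartesianProduct (permutations n) (allFin n)

∈-allVecs : ∀ {n m} (v : Vec (Fin n) m) → v ∈ allVecs n m
∈-allVecs []      = here refl
∈-allVecs (i ∷ v) = ∈-cartesianProductWith⁺ _∷_ (∈-allFin i) (∈-allVecs v)

instance
  outcomes-nonZero : ∀ {n} .{{_ : NonZero n}} → NonZero (length (Outcomes n))
  outcomes-nonZero {n@(suc _)} = >-nonZero (∈-length {x = identity , Fin.zero} {xs = Outcomes n}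
    (∈-cartesianProduct⁺ identity∈ (∈-allFin Fin.zero)))
    where
    identity : Contents n
    identity = tabulate id

    identity∈ : identity ∈ permutations n
    identity∈ = ∈-filter⁺ unique? (∈-allVecs identity) (tabulate⁺ id)

-- Alice names the two lockers whose cards she exchanges; naming the same
-- locker twice leaves everything unchanged.  Only her moves on contents that
-- are permutations matter.

record Strategy (n : ℕ) : Set where
  field
    swap   : Contents n → Fin n × Fin n
    first  : (s : Fin n) → Fin n
    second : (s card : Fin n) → Fin n

swapped : ∀ {n} → Fin n × Fin n → Contents n → Contents n
swapped (i , j) σ = tabulate (λ ℓ → lookup σ (transpose i j ℓ))

module _ {n : ℕ} (S : Strategy n) where
  open Strategy S

  afterAlice : Contents n → Contents n
  afterAlice σ = swapped (swap σ) σ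

  firstCard : Contents n → Fin n → Fin n
  firstCard σ s = lookup (afterAlice σ) (first s)

  secondCard : Contents n → Fin n → Fin n
  secondCard σ s = lookup (afterAlice σ) (second s (firstCard σ s))

  BobSucceeds : Contents n × Fin n → Set
  BobSucceeds (σ , s) = firstCard σ s ≡ s ⊎ secondCard σ s ≡ s

  bobSucceeds? : Decidable BobSucceeds
  bobSucceeds? (σ , s) = (firstCard σ s ≟ s) ⊎-dec (secondCard σ s ≟ s)

  successProbability : .{{_ : NonZero n}} → ℚ
  successProbability = Pr (Outcomes n) bobSucceeds?

{-# OPTIONS --safe #-}
module Submission where

-- Choose K ≤ n/4, about 2 log n / log log n, with 4^K n² ≤ K!.  Call a label s
-- found by Bob ascending if the card c in its first locker satisfies s ≤ c, and
-- descending if c < s.  It suffices that the expected number of ascending (and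
-- likewise of descending) labels after Alice's swap is at most K.
--
-- In a uniformly random arrangement, expose the lockers of a K-set T of labels
-- in the order of decreasing (respectively increasing) label.  When t's turn
-- comes, its card is not in the first locker of an earlier label of T, so t is
-- found with probability at most 2 / (n - 2K): exchange card t with the card of
-- any unexposed locker.  Hence the number Z of ascending labels satisfies
-- E (Z choose K) ≤ (n choose K) (2 / (n - 2K))^K ≤ 4^K / K!.  Since
-- Z ≤ (K - 1) + (Z choose K), summing (Z choose K) over all n² possible swaps
-- bounds E (Z after the swap) by (K - 1) + n² 4^K / K! ≤ K.

module Counting where

  open import Defs
  open import Data.Bool.Base using (true; false; if_then_else_)
  open import Data.Nat.Base hiding (_/_)
  open import Data.Nat.Properties hiding (_≟_)
  open import Algebra.Properties.CommutativeSemigroup +-commutativeSemigroup using (interchange)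
  open import Data.Nat.ListAction using (sum)
  open import Data.Nat.ListAction.Properties using (sum-++)
  open import Data.Nat.Tactic.RingSolver using (solve-∀)
  open import Data.Fin.Base as Fin using (Fin)
  open import Data.Fin.Properties using (_≟_; opposite-prop; opposite-involutive; toℕ<n)
    renaming (_≤?_ to _≤ꟳ?_; _<?_ to _<ꟳ?_; <⇒≢ to <ꟳ⇒≢)
  open import Data.Fin.Permutation.Components using (transpose; transpose-inverse)
  open import Data.List.Base as List using (List; []; _∷_; _++_; map; length; filter; allFin; cartesianProduct)
  open import Data.List.Properties using (map-++; length-tabulate; length-++; length-map; map-∘)
  open import Data.List.Membership.Propositional using (_∈_; _∉_)
  open import Data.List.Membership.Propositional.Properties
  open import Data.List.Membership.DecPropositional using () renaming (_∈?_ to mem?)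
  open import Data.List.Relation.Unary.Any using (here; there)
  open import Data.List.Relation.Unary.All as All using (All; []; _∷_)
  open import Data.List.Relation.Unary.AllPairs using (AllPairs; []; _∷_)
  open import Data.List.Relation.Unary.AllPairs.Properties using (tabulate⁺-<)
  open import Data.List.Relation.Unary.Unique.Propositional using () renaming (Unique to Uniqueᴸ)
  import Data.List.Relation.Unary.Unique.Propositional.Properties as Uᴸ
  open import Data.List.Relation.Binary.Sublist.Propositional using (_⊆_; []; _∷_; _∷ʳ_; minimum)
  open import Data.List.Relation.Binary.Sublist.Propositional.Properties using (All-resp-⊆)
  open import Data.Product.Base using (_,_; proj₁; proj₂; _×_)
  open import Data.Sum.Base using (_⊎_; inj₁; inj₂)
  open import Data.Vec.Base using (_∷_; lookup)
  open import Data.Vec.Properties using (lookup∘tabulate; tabulate∘lookup; tabulate-cong; ∷-injective)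
  open import Data.Vec.Relation.Unary.Unique.Propositional using (Unique)
  open import Data.Vec.Relation.Unary.Unique.Propositional.Properties using (tabulate⁺; lookup-injective)
  open import Function.Base using (_∘_; id)
  open import Relation.Binary.PropositionalEquality
  open import Relation.Nullary using (Dec; yes; no; does; ¬_; contradiction)
  open import Relation.Nullary.Decidable using (dec-true; dec-false; ¬?; _×-dec_)
  open import Relation.Unary using (Decidable)

  private
    variable
      A B : Set
      P : A → Set

  -- Finite sums and indicator functions.

  ∑ : List A → (A → ℕ) → ℕ
  ∑ xs f = sum (map f xs)

  syntax ∑ xs (λ x → e) = ∑[ x ∈ xs ] e
  infixr 6.5 ∑

  𝟙 : {X : Set} → Dec X → ℕ
  𝟙 X? = if does X? then 1 else 0

  𝟙-yes : {X : Set} (X? : Dec X) → X → 𝟙 X? ≡ 1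
  𝟙-yes X? x rewrite dec-true X? x = refl

  𝟙-mono : {X Y : Set} (X? : Dec X) (Y? : Dec Y) → (X → Y) → 𝟙 X? ≤ 𝟙 Y?
  𝟙-mono (no _)  Y? f = z≤n
  𝟙-mono (yes x) Y? f = ≤-reflexive (sym (𝟙-yes Y? (f x)))

  𝟙-⊎ : {X Y Z : Set} (X? : Dec X) (Y? : Dec Y) (Z? : Dec Z) → (X → Y ⊎ Z) → 𝟙 X? ≤ 𝟙 Y? + 𝟙 Z?
  𝟙-⊎ (no _)  Y? Z? f = z≤n
  𝟙-⊎ (yes x) Y? Z? f with f x
  ... | inj₁ y rewrite dec-true Y? y = s≤s z≤n
  ... | inj₂ z rewrite dec-true Z? z = m≤n+m 1 _

  ∑-mono : ∀ (xs : List A) {f g : A → ℕ} → (∀ {x} → x ∈ xs → f x ≤ g x) → ∑ xs f ≤ ∑ xs g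
  ∑-mono []       f≤g = z≤n
  ∑-mono (x ∷ xs) f≤g = +-mono-≤ (f≤g (here refl)) (∑-mono xs (f≤g ∘ there))

  ∑-cong : ∀ (xs : List A) {f g : A → ℕ} → (∀ x → f x ≡ g x) → ∑ xs f ≡ ∑ xs g
  ∑-cong []       f≡g = refl
  ∑-cong (x ∷ xs) f≡g = cong₂ _+_ (f≡g x) (∑-cong xs f≡g)

  ∑-const : ∀ (xs : List A) c → ∑[ _ ∈ xs ] c ≡ length xs * c
  ∑-const []       c = refl
  ∑-const (x ∷ xs) c = cong (c +_) (∑-const xs c)

  ∑-* : ∀ (xs : List A) f c → ∑[ x ∈ xs ] f x * c ≡ ∑ xs f * c
  ∑-* []       f c = refl
  ∑-* (x ∷ xs) f c = trans (cong (f x * c +_) (∑-* xs f c)) (sym (*-distribʳ-+ c (f x) (∑ xs f)))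

  ∑-+ : ∀ (xs : List A) f g → ∑[ x ∈ xs ] (f x + g x) ≡ ∑ xs f + ∑ xs g
  ∑-+ []       f g = refl
  ∑-+ (x ∷ xs) f g = trans (cong (f x + g x +_) (∑-+ xs f g)) (interchange (f x) (g x) _ _)

  ∑-comm : ∀ (xs : List A) (ys : List B) (f : A → B → ℕ) →
           ∑[ x ∈ xs ] ∑[ y ∈ ys ] f x y ≡ ∑[ y ∈ ys ] ∑[ x ∈ xs ] f x y
  ∑-comm []       ys f = sym (trans (∑-const ys 0) (*-zeroʳ (length ys)))
  ∑-comm (x ∷ xs) ys f = trans (cong (∑ ys (f x) +_) (∑-comm xs ys f)) (sym (∑-+ ys (f x) _))

  ∑-++ : ∀ (xs ys : List A) f → ∑ (xs ++ ys) f ≡ ∑ xs f + ∑ ys f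
  ∑-++ xs ys f = trans (cong sum (map-++ f xs ys)) (sum-++ (map f xs) (map f ys))

  ∑-map : ∀ (h : A → B) xs f → ∑ (map h xs) f ≡ ∑ xs (f ∘ h)
  ∑-map h xs f = cong sum (sym (map-∘ xs))

  ∑-cartesianProduct : ∀ (xs : List A) (ys : List B) f →
                       ∑ (cartesianProduct xs ys) f ≡ ∑[ x ∈ xs ] ∑[ y ∈ ys ] f (x , y)
  ∑-cartesianProduct []       ys f = refl
  ∑-cartesianProduct (x ∷ xs) ys f = trans (∑-++ (map (x ,_) ys) _ f)
    (cong₂ _+_ (∑-map (x ,_) ys f) (∑-cartesianProduct xs ys f))

  length-filter-∑ : (P? : Decidable P) (xs : List A) → length (filter P? xs) ≡ ∑[ x ∈ xs ] 𝟙 (P? x)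
  length-filter-∑ P? []       = refl
  length-filter-∑ P? (x ∷ xs) with does (P? x)
  ... | true  = cong suc (length-filter-∑ P? xs)
  ... | false = length-filter-∑ P? xs

  -- By induction on `xs`, the entry `f x` is struck out of `ys`; injectivity keeps the images of
  -- the remaining entries inside what is left. With `g` constantly 1 this compares lengths; with
  -- `f` a swap it compares expectations.
  ∑-injection : (f : A → B) {xs : List A} {ys : List B} (g : B → ℕ) → Uniqueᴸ xs →
                (∀ {x y} → x ∈ xs → y ∈ xs → f x ≡ f y → x ≡ y) →
                (∀ {x} → x ∈ xs → f x ∈ ys) →
                ∑[ x ∈ xs ] g (f x) ≤ ∑ ys g
  ∑-injection f g []         inj into = z≤n
  ∑-injection f {x ∷ xs} g (x≢ ∷ u) inj into with ∈-∃++ (into (here refl))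
  ... | ys , zs , refl = begin
    g (f x) + ∑ xs (g ∘ f)         ≤⟨ +-monoʳ-≤ (g (f x)) (∑-injection f g u (λ p q → inj (there p) (there q)) into′) ⟩
    g (f x) + ∑ (ys ++ zs) g       ≡⟨ cong (g (f x) +_) (∑-++ ys zs g) ⟩
    g (f x) + (∑ ys g + ∑ zs g)    ≡⟨ +-assoc (g (f x)) _ _ ⟨
    g (f x) + ∑ ys g + ∑ zs g      ≡⟨ cong (_+ ∑ zs g) (+-comm (g (f x)) _) ⟩
    ∑ ys g + g (f x) + ∑ zs g      ≡⟨ +-assoc (∑ ys g) _ _ ⟩
    ∑ ys g + (g (f x) + ∑ zs g)    ≡⟨ ∑-++ ys (f x ∷ zs) g ⟨
    ∑ (ys ++ f x ∷ zs) g           ∎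
    where
    open ≤-Reasoning
    into′ : ∀ {y} → y ∈ xs → f y ∈ ys ++ zs
    into′ y∈ with ∈-++⁻ ys (into (there y∈))
    ... | inj₁ p         = ∈-++⁺ˡ p
    ... | inj₂ (there p) = ∈-++⁺ʳ ys p
    ... | inj₂ (here eq) = contradiction (sym (inj (there y∈) (here refl) eq)) (All.lookup x≢ y∈)

  length-injection : (f : A → B) {xs : List A} {ys : List B} → Uniqueᴸ xs →
                (∀ {x y} → x ∈ xs → y ∈ xs → f x ≡ f y → x ≡ y) →
                (∀ {x} → x ∈ xs → f x ∈ ys) → length xs ≤ length ys
  length-injection f {xs} {ys} u inj into = subst₂ _≤_ (card xs) (card ys) (∑-injection f (λ _ → 1) u inj into)
    where
    card : ∀ {C : Set} (zs : List C) → ∑[ _ ∈ zs ] 1 ≡ length zs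
    card zs = trans (∑-const zs 1) (*-identityʳ (length zs))

  -- Arrangements of the cards and the action of swaps on them.

  module _ {n : ℕ} where

    _∈?_ : (ℓ : Fin n) (E : List (Fin n)) → Dec (ℓ ∈ E)
    _∈?_ = mem? _≟_

    -- The distinct entries of `E` number at most its length, and repetitions only leave more
    -- lockers free.
    ∉-count : (E : List (Fin n)) → n ∸ length E ≤ ∑[ ℓ ∈ allFin n ] 𝟙 (¬? (ℓ ∈? E))
    ∉-count E = begin
      n ∸ length E                                 ≤⟨ ∸-monoʳ-≤ n members≤ ⟩
      n ∸ members                                  ≡⟨ cong (_∸ members) split ⟨
      (members + ∑[ ℓ ∈ allFin n ] 𝟙 (¬? (ℓ ∈? E))) ∸ members ≡⟨ m+n∸m≡n members _ ⟩
      ∑[ ℓ ∈ allFin n ] 𝟙 (¬? (ℓ ∈? E))            ∎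
      where
      open ≤-Reasoning
      members = ∑[ ℓ ∈ allFin n ] 𝟙 (ℓ ∈? E)
      members≤ : members ≤ length E
      members≤ = begin
        members                              ≡⟨ length-filter-∑ (_∈? E) (allFin n) ⟨
        length (filter (_∈? E) (allFin n))   ≤⟨ length-injection id (Uᴸ.filter⁺ (_∈? E) (Uᴸ.allFin⁺ n)) (λ _ _ eq → eq)
                                                  (proj₂ ∘ ∈-filter⁻ (_∈? E) {xs = allFin n}) ⟩
        length E                             ∎
      complement : ∀ {X : Set} (X? : Dec X) → 𝟙 X? + 𝟙 (¬? X?) ≡ 1
      complement (yes _) = refl
      complement (no _)  = refl
      split : members + ∑[ ℓ ∈ allFin n ] 𝟙 (¬? (ℓ ∈? E)) ≡ n
      split = trans (sym (∑-+ (allFin n) _ _))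
        (trans (∑-cong (allFin n) (λ ℓ → complement (ℓ ∈? E)))
          (trans (∑-const (allFin n) 1)
            (trans (*-identityʳ _) (length-tabulate id))))

    transpose-other : ∀ {i j k : Fin n} → k ≢ i → k ≢ j → transpose i j k ≡ k
    transpose-other {i} {j} {k} k≢i k≢j rewrite dec-false (k ≟ i) k≢i | dec-false (k ≟ j) k≢j = refl

    transpose-right : ∀ (i j : Fin n) → transpose i j j ≡ i
    transpose-right i j with j ≟ i
    ... | yes j≡i = j≡i
    ... | no _ rewrite dec-true (j ≟ j) refl = refl

    lookup-swapped : ∀ i j (σ : Contents n) k → lookup (swapped (i , j) σ) k ≡ lookup σ (transpose i j k)
    lookup-swapped i j σ k = lookup∘tabulate _ k

    swapped-other : ∀ {i j k} (σ : Contents n) → k ≢ i → k ≢ j → lookup (swapped (i , j) σ) k ≡ lookup σ k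
    swapped-other {i} {j} {k} σ k≢i k≢j = trans (lookup-swapped i j σ k) (cong (lookup σ) (transpose-other k≢i k≢j))

    swapped-right : ∀ i j (σ : Contents n) → lookup (swapped (i , j) σ) j ≡ lookup σ i
    swapped-right i j σ = trans (lookup-swapped i j σ j) (cong (lookup σ) (transpose-right i j))

    swapped-undo : ∀ i j (σ : Contents n) → swapped (j , i) (swapped (i , j) σ) ≡ σ
    swapped-undo i j σ = trans (tabulate-cong same) (tabulate∘lookup σ)
      where
      same : ∀ k → lookup (swapped (i , j) σ) (transpose j i k) ≡ lookup σ k
      same k = trans (lookup-swapped i j σ _) (cong (lookup σ) (transpose-inverse i j))

    swapped-injective : ∀ i j {σ τ : Contents n} → swapped (i , j) σ ≡ swapped (i , j) τ → σ ≡ τ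
    swapped-injective i j {σ} {τ} eq =
      trans (sym (swapped-undo i j σ)) (trans (cong (swapped (j , i)) eq) (swapped-undo i j τ))

    swapped-unique : ∀ i j {σ : Contents n} → Unique σ → Unique (swapped (i , j) σ)
    swapped-unique i j {σ} u = tabulate⁺ λ {k} {l} eq →
      trans (sym (transpose-inverse j i))
        (trans (cong (transpose j i) (lookup-injective u _ _ eq)) (transpose-inverse j i))

    allVecs-unique : ∀ m → Uniqueᴸ (allVecs n m)
    allVecs-unique zero    = [] ∷ []
    allVecs-unique (suc m) = Uᴸ.cartesianProductWith⁺ _∷_ ∷-injective (Uᴸ.allFin⁺ n) (allVecs-unique m)

    permutations-unique : Uniqueᴸ (permutations n)
    permutations-unique = Uᴸ.filter⁺ unique? (allVecs-unique n)

    ∈-permutations⁺ : ∀ {σ : Contents n} → Unique σ → σ ∈ permutations n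
    ∈-permutations⁺ {σ} u = ∈-filter⁺ unique? (∈-allVecs σ) u

    ∈-permutations⁻ : ∀ {σ : Contents n} → σ ∈ permutations n → Unique σ
    ∈-permutations⁻ p = proj₂ (∈-filter⁻ unique? {xs = allVecs n n} p)

    swapped-∈ : ∀ i j {σ : Contents n} → σ ∈ permutations n → swapped (i , j) σ ∈ permutations n
    swapped-∈ i j p = ∈-permutations⁺ (swapped-unique i j (∈-permutations⁻ p))

    count : {P : Contents n → Set} → Decidable P → ℕ
    count P? = ∑[ σ ∈ permutations n ] 𝟙 (P? σ)

    count-filter : {P : Contents n → Set} (P? : Decidable P) → length (filter P? (permutations n)) ≡ count P?
    count-filter P? = length-filter-∑ P? (permutations n)

    -- A fixed swap is injective on the arrangements, so a uniformly random arrangement stays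
    -- uniform under it. This is what allows each single swap to be treated like no swap at all.
    ∑-swapped : ∀ i j (g : Contents n → ℕ) →
                ∑[ σ ∈ permutations n ] g (swapped (i , j) σ) ≤ ∑ (permutations n) g
    ∑-swapped i j g = ∑-injection (swapped (i , j)) g permutations-unique
      (λ _ _ → swapped-injective i j) (swapped-∈ i j)

    -- The locker ℓ receiving card t and the locker pos σ giving it away are both
    -- read off the new arrangement, so (σ , ℓ) ↦ swapped (pos σ , ℓ) σ is injective.

    switching : {P Q : Contents n → Set} (P? : Decidable P) (Q? : Decidable Q) (t : Fin n)
                (pos : Contents n → Fin n) (E : Contents n → List (Fin n)) (e : ℕ) →
                (∀ σ → length (E σ) ≤ e) →
                (∀ {σ} → P σ → lookup σ (pos σ) ≡ t) →
                (∀ {σ ℓ} → P σ → ℓ ∉ E σ →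
                   Q (swapped (pos σ , ℓ) σ) × pos (swapped (pos σ , ℓ) σ) ≡ pos σ) →
                count P? * (n ∸ e) ≤ count Q?
    switching {P} {Q} P? Q? t pos E e size at-pos switch = begin
      count P? * (n ∸ e)                               ≡⟨ ∑-* (permutations n) _ (n ∸ e) ⟨
      ∑[ σ ∈ permutations n ] 𝟙 (P? σ) * (n ∸ e)       ≤⟨ ∑-mono (permutations n) (λ {σ} _ → choices σ) ⟩
      ∑[ σ ∈ permutations n ] ∑[ ℓ ∈ allFin n ] 𝟙 (switchable? (σ , ℓ))
                                                       ≡⟨ ∑-cartesianProduct (permutations n) (allFin n) _ ⟨
      ∑[ x ∈ pairs ] 𝟙 (switchable? x)                 ≡⟨ length-filter-∑ switchable? pairs ⟨
      length (filter switchable? pairs)                ≤⟨ length-injection act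
                                                            (Uᴸ.filter⁺ switchable? (Uᴸ.cartesianProduct⁺ permutations-unique (Uᴸ.allFin⁺ n)))
                                                            injective into ⟩
      length (filter Q? (permutations n))              ≡⟨ count-filter Q? ⟩
      count Q?                                         ∎
      where
      open ≤-Reasoning
      pairs : List (Contents n × Fin n)
      pairs = cartesianProduct (permutations n) (allFin n)
      switchable? : Decidable (λ ((σ , ℓ) : Contents n × Fin n) → P σ × ℓ ∉ E σ)
      switchable? (σ , ℓ) = P? σ ×-dec ¬? (ℓ ∈? E σ)
      act : Contents n × Fin n → Contents n
      act (σ , ℓ) = swapped (pos σ , ℓ) σ

      choices : ∀ σ → 𝟙 (P? σ) * (n ∸ e) ≤ ∑[ ℓ ∈ allFin n ] 𝟙 (switchable? (σ , ℓ))
      choices σ with P? σ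
      ... | no  _ = z≤n
      ... | yes p = begin
        1 * (n ∸ e)                             ≡⟨ *-identityˡ (n ∸ e) ⟩
        n ∸ e                                   ≤⟨ ∸-monoʳ-≤ n (size σ) ⟩
        n ∸ length (E σ)                        ≤⟨ ∉-count (E σ) ⟩
        ∑[ ℓ ∈ allFin n ] 𝟙 (¬? (ℓ ∈? E σ))     ∎

      spec : ∀ {x} → x ∈ filter switchable? pairs → proj₁ x ∈ permutations n × P (proj₁ x) × proj₂ x ∉ E (proj₁ x)
      spec x∈ with ∈-filter⁻ switchable? {xs = pairs} x∈
      ... | x∈pairs , p , ℓ∉ = proj₁ (∈-cartesianProduct⁻ (permutations n) (allFin n) x∈pairs) , p , ℓ∉

      into : ∀ {x} → x ∈ filter switchable? pairs → act x ∈ filter Q? (permutations n)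
      into {σ , ℓ} x∈ with spec x∈
      ... | σ∈ , p , ℓ∉ = ∈-filter⁺ Q? (swapped-∈ (pos σ) ℓ σ∈) (proj₁ (switch p ℓ∉))

      injective : ∀ {x y} → x ∈ filter switchable? pairs → y ∈ filter switchable? pairs → act x ≡ act y → x ≡ y
      injective {σ , ℓ} {τ , m} x∈ y∈ eq with spec x∈ | spec y∈
      ... | σ∈ , pσ , ℓ∉ | τ∈ , pτ , m∉ = same same-pos same-locker eq
        where
        same-pos : pos σ ≡ pos τ
        same-pos = trans (sym (proj₂ (switch pσ ℓ∉))) (trans (cong pos eq) (proj₂ (switch pτ m∉)))
        same-locker : ℓ ≡ m
        same-locker = lookup-injective (∈-permutations⁻ (swapped-∈ (pos τ) m τ∈)) ℓ m
          (trans (cong (λ ρ → lookup ρ ℓ) (sym eq))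
            (trans (swapped-right (pos σ) ℓ σ)
              (trans (at-pos pσ) (sym (trans (swapped-right (pos τ) m τ) (at-pos pτ))))))
        same : ∀ {i j ℓ m} → i ≡ j → ℓ ≡ m → swapped (i , ℓ) σ ≡ swapped (j , m) τ → (σ , ℓ) ≡ (τ , m)
        same {i} {j} {ℓ} refl refl eq = cong (_, ℓ) (swapped-injective i ℓ eq)

  -- Sublists of a given length.

  sublists : ℕ → List A → List (List A)
  sublists zero    xs       = [] ∷ []
  sublists (suc k) []       = []
  sublists (suc k) (x ∷ xs) = map (x ∷_) (sublists k xs) ++ sublists (suc k) xs

  -- The order of `xs` is kept, so that a sublist inherits from `xs` every relation holding between
  -- earlier and later entries.
  ∈-sublists⁻ : ∀ k (xs : List A) {ys} → ys ∈ sublists k xs → ys ⊆ xs × length ys ≡ k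
  ∈-sublists⁻ zero    xs       (here refl) = minimum xs , refl
  ∈-sublists⁻ (suc k) (x ∷ xs) ys∈ with ∈-++⁻ (map (x ∷_) (sublists k xs)) ys∈
  ... | inj₂ p = let ys⊆ , eq = ∈-sublists⁻ (suc k) xs p in x ∷ʳ ys⊆ , eq
  ... | inj₁ p with ∈-map⁻ (x ∷_) p
  ...   | zs , q , refl = let zs⊆ , eq = ∈-sublists⁻ k xs q in refl ∷ zs⊆ , cong suc eq

  -- The left side consists of the first two terms of the binomial expansion of the right side. It
  -- closes the Pascal recursion in `length-sublists`.
  ^-suc-superadditive : ∀ m k → m ^ suc k + suc k * m ^ k ≤ suc m ^ suc k
  ^-suc-superadditive m zero    = ≤-reflexive (identity m)
    where
    identity : ∀ m → m * 1 + (1 + 0) * 1 ≡ (1 + m) * 1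
    identity = solve-∀
  ^-suc-superadditive m (suc k) = begin
    m ^ suc (suc k) + suc (suc k) * m ^ suc k                 ≤⟨ m≤m+n _ (suc k * m ^ k) ⟩
    m * (m * p) + suc (suc k) * (m * p) + suc k * p           ≡⟨ identity m p k ⟩
    suc m * (m ^ suc k + suc k * m ^ k)                       ≤⟨ *-monoʳ-≤ (suc m) (^-suc-superadditive m k) ⟩
    suc m ^ suc (suc k)                                       ∎
    where
    open ≤-Reasoning
    p = m ^ k
    identity : ∀ m p k → m * (m * p) + (1 + (1 + k)) * (m * p) + (1 + k) * p ≡ (1 + m) * (m * p + (1 + k) * p)
    identity = solve-∀

  -- The number of sublists obeys Pascal's rule, so it is a binomial coefficient; the factor `k !`
  -- stands on the left to avoid a division.
  length-sublists : ∀ k (xs : List A) → length (sublists k xs) * k ! ≤ length xs ^ k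
  length-sublists zero    xs       = ≤-refl
  length-sublists (suc k) []       = z≤n
  length-sublists (suc k) (x ∷ xs) = begin
    length (map (x ∷_) (sublists k xs) ++ sublists (suc k) xs) * suc k !
      ≡⟨ cong (_* suc k !) (trans (length-++ (map (x ∷_) (sublists k xs))) (cong (_+ b) (length-map (x ∷_) (sublists k xs)))) ⟩
    (a + b) * (suc k * k !)               ≡⟨ identity a b k (k !) ⟩
    b * (suc k * k !) + suc k * (a * k !)
      ≤⟨ +-mono-≤ (length-sublists (suc k) xs) (*-monoʳ-≤ (suc k) (length-sublists k xs)) ⟩
    length xs ^ suc k + suc k * length xs ^ k  ≤⟨ ^-suc-superadditive (length xs) k ⟩
    suc (length xs) ^ suc k ∎
    where
    open ≤-Reasoning
    a = length (sublists k xs)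
    b = length (sublists (suc k) xs)
    identity : ∀ a b k f → (a + b) * ((1 + k) * f) ≡ b * ((1 + k) * f) + (1 + k) * (a * f)
    identity = solve-∀

  -- m ∸ k ≤ m C (k + 1), where m of the entries of xs satisfy P.

  count≤sublists : (P? : Decidable P) (k : ℕ) (xs : List A) →
                   ∑[ x ∈ xs ] 𝟙 (P? x) ≤ k + ∑[ ys ∈ sublists (suc k) xs ] 𝟙 (All.all? P? ys)
  count≤sublists P? k [] = z≤n
  count≤sublists {P = P} P? k (x ∷ xs) = begin
    𝟙 (P? x) + ∑[ y ∈ xs ] 𝟙 (P? y)                                          ≤⟨ step k (P? x) ⟩
    k + (∑[ ys ∈ sublists k xs ] χ (x ∷ ys) + ∑ (sublists (suc k) xs) χ)
      ≡⟨ cong (λ z → k + (z + ∑ (sublists (suc k) xs) χ)) (∑-map (x ∷_) (sublists k xs) χ) ⟨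
    k + (∑ (map (x ∷_) (sublists k xs)) χ + ∑ (sublists (suc k) xs) χ)
      ≡⟨ cong (k +_) (∑-++ (map (x ∷_) (sublists k xs)) (sublists (suc k) xs) χ) ⟨
    k + ∑ (sublists (suc k) (x ∷ xs)) χ                                      ∎
    where
    open ≤-Reasoning
    χ : List _ → ℕ
    χ ys = 𝟙 (All.all? P? ys)
    containing : ∀ k → P x → ∑ (sublists k xs) χ ≤ ∑[ ys ∈ sublists k xs ] χ (x ∷ ys)
    containing k p = ∑-mono (sublists k xs) (λ {ys} _ → 𝟙-mono (All.all? P? ys) (All.all? P? (x ∷ ys)) (p ∷_))
    step : ∀ k (p : Dec (P x)) →
           𝟙 p + ∑[ y ∈ xs ] 𝟙 (P? y) ≤ k + (∑[ ys ∈ sublists k xs ] χ (x ∷ ys) + ∑ (sublists (suc k) xs) χ)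
    step k       (no _)  = ≤-trans (count≤sublists P? k xs) (+-monoʳ-≤ k (m≤n+m _ _))
    -- When `x` satisfies `P`, its own 1 is paid by the empty sublist if `k` is 0, and by one unit
    -- of `k` otherwise.
    step zero    (yes p) = +-mono-≤ (containing zero p) (count≤sublists P? zero xs)
    step (suc k) (yes p) = s≤s (≤-trans (count≤sublists P? k xs)
      (+-monoʳ-≤ k (≤-trans (containing (suc k) p) (m≤m+n _ _))))

  length-cartesianProduct : ∀ (xs : List A) (ys : List B) → length (cartesianProduct xs ys) ≡ length xs * length ys
  length-cartesianProduct []       ys = refl
  length-cartesianProduct (x ∷ xs) ys = trans (length-++ (map (x ,_) ys))
    (cong₂ _+_ (length-map (x ,_) ys) (length-cartesianProduct xs ys))

  AllPairs-resp-⊆ : {_~_ : A → A → Set} {xs ys : List A} → xs ⊆ ys → AllPairs _~_ ys → AllPairs _~_ xs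
  AllPairs-resp-⊆ []       []           = []
  AllPairs-resp-⊆ (_ ∷ʳ p) (_ ∷ rel)    = AllPairs-resp-⊆ p rel
  AllPairs-resp-⊆ (refl ∷ p) (~x ∷ rel) = All-resp-⊆ p ~x ∷ AllPairs-resp-⊆ p rel

  -- Labels found by Bob, and their exposure along a chain.

  module _ {n : ℕ} (S : Strategy n) where
    open Strategy S

    -- One locker answers for both of Bob's openings, so that success on `t` becomes the single
    -- equation `lookup σ (locate σ t) ≡ t`. It depends on `σ` only through the card in `first t`.
    locate : Contents n → Fin n → Fin n
    locate σ t = if does (lookup σ (first t) ≟ t) then first t else second t (lookup σ (first t))

    found-locate : ∀ σ t → lookup σ (first t) ≡ t ⊎ lookup σ (second t (lookup σ (first t))) ≡ t →
                   lookup σ (locate σ t) ≡ t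
    found-locate σ t found with lookup σ (first t) ≟ t | found
    ... | yes eq | _       = eq
    ... | no neq | inj₁ eq = contradiction eq neq
    ... | no _   | inj₂ eq = eq

    -- The ascending and the descending labels are treated by one argument: `Admissible` compares a
    -- label with the card in its first locker, and is instantiated with two complementary
    -- relations.
    module Class (Admissible : Fin n → Fin n → Set) (admissible? : ∀ t c → Dec (Admissible t c)) where

      Good : Contents n → Fin n → Set
      Good σ t = Admissible t (lookup σ (first t)) × lookup σ (locate σ t) ≡ t

      good? : ∀ σ → Decidable (Good σ)
      good? σ t = admissible? t (lookup σ (first t)) ×-dec (lookup σ (locate σ t) ≟ t)

      allGood? : ∀ ts → Decidable (λ σ → All (Good σ) ts)
      allGood? ts σ = All.all? (good? σ) ts

      -- t ▷ u ensures that, if u is found admissibly, its first locker does not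
      -- hold t; labels can then be exposed from the last entry of a ▷-chain to
      -- the first.

      _▷_ : Fin n → Fin n → Set
      t ▷ u = t ≢ u × ¬ Admissible u t

      exposed : List (Fin n) → Contents n → List (Fin n)
      exposed ts σ = map first ts ++ map (locate σ) ts

      length-exposed : ∀ ts σ → length (exposed ts σ) ≡ length ts + length ts
      length-exposed ts σ = trans (length-++ (map first ts))
        (cong₂ _+_ (length-map first ts) (length-map (locate σ) ts))

      -- Neither locker that matters for `u` is touched. Its first locker is not `a`, since card `t`
      -- there would not be admissible; the locker holding card `u` is not `a`, since `a` holds `t`;
      -- and `ℓ` differs from both by assumption. As the first card stays, `locate` stays too.
      good-stable : ∀ σ {a ℓ t u} → lookup σ a ≡ t → t ▷ u → first u ≢ ℓ → locate σ u ≢ ℓ →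
                    Good σ u → Good (swapped (a , ℓ) σ) u
      good-stable σ {a} {ℓ} {t} {u} σa≡t (t≢u , ¬adm) first≢ℓ locate≢ℓ (adm , found) =
        subst (Admissible u) (sym first-same) adm ,
        trans (cong (lookup τ) locate-same) (trans (swapped-other σ locate≢a locate≢ℓ) found)
        where
        τ = swapped (a , ℓ) σ
        first≢a : first u ≢ a
        first≢a eq = ¬adm (subst (Admissible u) (trans (cong (lookup σ) eq) σa≡t) adm)
        locate≢a : locate σ u ≢ a
        locate≢a eq = t≢u (trans (sym σa≡t) (trans (cong (lookup σ) (sym eq)) found))
        first-same : lookup τ (first u) ≡ lookup σ (first u)
        first-same = swapped-other σ first≢a first≢ℓ
        locate-same : locate τ u ≡ locate σ u
        locate-same = cong (λ c → if does (c ≟ u) then first u else second u c) first-same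

      allGood-stable : ∀ σ {a ℓ t us} → lookup σ a ≡ t → All (t ▷_) us → ℓ ∉ exposed us σ →
                       All (Good σ) us → All (Good (swapped (a , ℓ) σ)) us
      allGood-stable σ {us = us} σa≡t t▷us ℓ∉ good = All.tabulate λ {u} u∈ →
        good-stable σ σa≡t (All.lookup t▷us u∈)
          (λ eq → ℓ∉ (∈-++⁺ˡ (subst (_∈ map first us) eq (∈-map⁺ first u∈))))
          (λ eq → ℓ∉ (∈-++⁺ʳ (map first us) (subst (_∈ map (locate σ) us) eq (∈-map⁺ (locate σ) u∈))))
          (All.lookup good u∈)

      -- Card t sits either in its first locker or in its second one; in both
      -- cases that locker survives the switching with any unexposed locker.

      chain-step : ∀ {t us e} → All (t ▷_) us → suc (length us + length us) ≤ e →
                   count (allGood? (t ∷ us)) * (n ∸ e) ≤ 2 * count (allGood? us)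
      chain-step {t} {us} {e} t▷us size = begin
        count (allGood? (t ∷ us)) * (n ∸ e)
          ≤⟨ *-monoˡ-≤ (n ∸ e) (∑-mono (permutations n) (λ {σ} _ → 𝟙-⊎ (allGood? (t ∷ us) σ) (atFirst? σ) (atSecond? σ) (split σ))) ⟩
        (∑[ σ ∈ permutations n ] (𝟙 (atFirst? σ) + 𝟙 (atSecond? σ))) * (n ∸ e)
          ≡⟨ cong (_* (n ∸ e)) (∑-+ (permutations n) (𝟙 ∘ atFirst?) (𝟙 ∘ atSecond?)) ⟩
        (count atFirst? + count atSecond?) * (n ∸ e)
          ≡⟨ *-distribʳ-+ (n ∸ e) (count atFirst?) (count atSecond?) ⟩
        count atFirst? * (n ∸ e) + count atSecond? * (n ∸ e)
          ≤⟨ +-mono-≤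
               (switching atFirst? (allGood? us) t (λ _ → first t) E e size′ proj₁
                 (λ {σ} (here-t , good) ℓ∉ → allGood-stable σ here-t t▷us (ℓ∉ ∘ there) good , refl))
               (switching atSecond? (allGood? us) t (λ σ → second t (lookup σ (first t))) E e size′ (proj₁ ∘ proj₂)
                 -- The second locker is chosen by the card in `first t`. That card does not move:
                 -- `first t` does not hold `t`, so it is not the locker giving `t` away, and it
                 -- belongs to `E`, so it is not `ℓ`.
                 (λ {σ} (not-first , here-t , good) ℓ∉ → allGood-stable σ here-t t▷us (ℓ∉ ∘ there) good ,
                   cong (second t) (swapped-other σ
                     (λ eq → not-first (trans (cong (lookup σ) eq) here-t)) (λ eq → ℓ∉ (here (sym eq)))))) ⟩
        count (allGood? us) + count (allGood? us)
          ≡⟨ cong (count (allGood? us) +_) (+-identityʳ (count (allGood? us))) ⟨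
        2 * count (allGood? us) ∎
        where
        open ≤-Reasoning
        E : Contents n → List (Fin n)
        E σ = first t ∷ exposed us σ
        size′ : ∀ σ → length (E σ) ≤ e
        size′ σ = ≤-trans (≤-reflexive (cong suc (length-exposed us σ))) size
        AtFirst AtSecond : Contents n → Set
        AtFirst  σ = lookup σ (first t) ≡ t × All (Good σ) us
        AtSecond σ = lookup σ (first t) ≢ t × lookup σ (second t (lookup σ (first t))) ≡ t × All (Good σ) us
        atFirst? : Decidable AtFirst
        atFirst? σ = (lookup σ (first t) ≟ t) ×-dec allGood? us σ
        atSecond? : Decidable AtSecond
        atSecond? σ = ¬? (lookup σ (first t) ≟ t) ×-dec
          ((lookup σ (second t (lookup σ (first t))) ≟ t) ×-dec allGood? us σ)
        split : ∀ σ → All (Good σ) (t ∷ us) → AtFirst σ ⊎ AtSecond σ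
        split σ ((_ , found) ∷ good) with lookup σ (first t) ≟ t
        ... | yes eq = inj₁ (eq , good)
        ... | no neq = inj₂ (neq , found , good)

      -- The head of the list is exposed last, so peeling it off costs one factor 2 / (n - e).
      -- Keeping `e` fixed at a bound for the whole list makes all these factors equal.
      chain-bound : ∀ ts {e} → AllPairs _▷_ ts → length ts + length ts ≤ e →
                    count (allGood? ts) * (n ∸ e) ^ length ts ≤ 2 ^ length ts * length (permutations n)
      chain-bound []       {e} []           size = ≤-reflexive (trans (*-identityʳ _)
        (trans (∑-const (permutations n) 1) (*-comm (length (permutations n)) 1)))
      chain-bound (t ∷ us) {e} (t▷us ∷ chain) size = begin
        count (allGood? (t ∷ us)) * (d * d ^ length us)    ≡⟨ *-assoc (count (allGood? (t ∷ us))) d _ ⟨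
        count (allGood? (t ∷ us)) * d * d ^ length us      ≤⟨ *-monoˡ-≤ (d ^ length us) (chain-step t▷us (≤-trans (+-monoʳ-≤ (suc (length us)) (n≤1+n (length us))) size)) ⟩
        2 * count (allGood? us) * d ^ length us            ≡⟨ *-assoc 2 (count (allGood? us)) _ ⟩
        2 * (count (allGood? us) * d ^ length us)          ≤⟨ *-monoʳ-≤ 2 (chain-bound us chain (≤-trans (+-mono-≤ (n≤1+n (length us)) (n≤1+n (length us))) size)) ⟩
        2 * (2 ^ length us * length (permutations n))      ≡⟨ *-assoc 2 (2 ^ length us) _ ⟨
        2 ^ suc (length us) * length (permutations n)      ∎
        where
        open ≤-Reasoning
        d = n ∸ e

      module _ {xs : List (Fin n)} (chain : AllPairs _▷_ xs) (length-xs : length xs ≡ n)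
               (k : ℕ) (4K≤n : 4 * suc k ≤ n) where

        private
          K d p : ℕ
          K = suc k
          d = n ∸ (K + K)
          p = length (permutations n)

        -- Turns the factor 2 / d of each exposure into at most 4 / n, the source of the base 4.
        n≤2d : n ≤ 2 * d
        n≤2d = +-cancelʳ-≤ (4 * K) n (2 * d) (begin
          n + 4 * K                        ≤⟨ +-monoʳ-≤ n 4K≤n ⟩
          n + n                            ≡⟨ cong (λ z → z + z) (m∸n+n≡m 2K≤n) ⟨
          (d + (K + K)) + (d + (K + K))    ≡⟨ identity d K ⟩
          2 * d + 4 * K                    ∎)
          where
          open ≤-Reasoning
          2K≤n : K + K ≤ n
          2K≤n = ≤-trans (+-monoʳ-≤ K (m≤m+n K _)) 4K≤n
          identity : ∀ d K → (d + (K + K)) + (d + (K + K)) ≡ 2 * d + 4 * K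
          identity = solve-∀

        d-nonZero : NonZero d
        d-nonZero = ≢-nonZero λ d≡0 → contradiction
          (≤-trans 4K≤n (≤-trans n≤2d (≤-reflexive (cong (2 *_) d≡0)))) λ ()

        -- There are at most n^K / K! sublists, each entirely good in at most a fraction (2 / d)^K
        -- of the arrangements, and `n ≤ 2 * d` leaves 4^K. The factor `d ^ K` is carried along and
        -- cancelled at the end.
        sublists-bound : (∑[ ts ∈ sublists K xs ] count (allGood? ts)) * K ! ≤ 4 ^ K * p
        sublists-bound = *-cancelʳ-≤ (m * K !) (4 ^ K * p) (d ^ K) {{m^n≢0 d K {{d-nonZero}}}} (begin
          m * K ! * d ^ K                 ≡⟨ swap-right m (K !) (d ^ K) ⟩
          m * d ^ K * K !                 ≤⟨ *-monoˡ-≤ (K !) each ⟩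
          l * (2 ^ K * p) * K !           ≡⟨ swap-right l (2 ^ K * p) (K !) ⟩
          l * K ! * (2 ^ K * p)           ≤⟨ *-monoˡ-≤ (2 ^ K * p) (length-sublists K xs) ⟩
          length xs ^ K * (2 ^ K * p)     ≡⟨ cong (λ z → z ^ K * (2 ^ K * p)) length-xs ⟩
          n ^ K * (2 ^ K * p)             ≤⟨ *-monoˡ-≤ (2 ^ K * p) (^-monoˡ-≤ K n≤2d) ⟩
          (2 * d) ^ K * (2 ^ K * p)       ≡⟨ cong (_* (2 ^ K * p)) (^-distribʳ-* K 2 d) ⟩
          2 ^ K * d ^ K * (2 ^ K * p)     ≡⟨ rearrange (2 ^ K) (d ^ K) p ⟩
          2 ^ K * 2 ^ K * p * d ^ K       ≡⟨ cong (λ z → z * p * d ^ K) (^-distribʳ-* K 2 2) ⟨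
          4 ^ K * p * d ^ K               ∎)
          where
          open ≤-Reasoning
          m l : ℕ
          m = ∑[ ts ∈ sublists K xs ] count (allGood? ts)
          l = length (sublists K xs)
          swap-right : ∀ a b c → a * b * c ≡ a * c * b
          swap-right = solve-∀
          rearrange : ∀ a b c → a * b * (a * c) ≡ a * a * c * b
          rearrange = solve-∀
          ^-distribʳ-* : ∀ k a b → (a * b) ^ k ≡ a ^ k * b ^ k
          ^-distribʳ-* zero    a b = refl
          ^-distribʳ-* (suc k) a b = trans (cong (a * b *_) (^-distribʳ-* k a b)) (interchange-* a b (a ^ k) (b ^ k))
            where
            interchange-* : ∀ a b c d → a * b * (c * d) ≡ a * c * (b * d)
            interchange-* = solve-∀
          each : m * d ^ K ≤ l * (2 ^ K * p)
          each = begin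
            m * d ^ K                                                   ≡⟨ ∑-* (sublists K xs) (count ∘ allGood?) (d ^ K) ⟨
            ∑[ ts ∈ sublists K xs ] count (allGood? ts) * d ^ K         ≤⟨ ∑-mono (sublists K xs) one ⟩
            ∑[ ts ∈ sublists K xs ] 2 ^ K * p                           ≡⟨ ∑-const (sublists K xs) (2 ^ K * p) ⟩
            l * (2 ^ K * p)                                             ∎
            where
            one : ∀ {ts} → ts ∈ sublists K xs → count (allGood? ts) * d ^ K ≤ 2 ^ K * p
            one {ts} ts∈ with ∈-sublists⁻ K xs ts∈
            ... | ts⊆ , len = subst (λ j → count (allGood? ts) * d ^ j ≤ 2 ^ j * p) len
              (chain-bound ts (AllPairs-resp-⊆ ts⊆ chain) (≤-reflexive (cong₂ _+_ len len)))

        -- Alice's best swap is replaced by the sum over all n² swaps, each of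
        -- which permutes the arrangements.

        swaps-bound : n * n * 4 ^ K ≤ K ! →
                      ∑[ σ ∈ permutations n ] ∑[ t ∈ xs ] 𝟙 (good? (afterAlice S σ) t) ≤ K * p
        swaps-bound small = begin
          ∑[ σ ∈ permutations n ] ∑[ t ∈ xs ] 𝟙 (good? (afterAlice S σ) t)
            ≤⟨ ∑-mono (permutations n) (λ {σ} _ → ≤-trans (count≤sublists (good? (afterAlice S σ)) k xs) (+-monoʳ-≤ k (over-swaps σ))) ⟩
          ∑[ σ ∈ permutations n ] (k + ∑[ s ∈ swaps ] χ (swapped s σ))
            ≡⟨ ∑-+ (permutations n) (λ _ → k) _ ⟩
          ∑[ σ ∈ permutations n ] k + ∑[ σ ∈ permutations n ] ∑[ s ∈ swaps ] χ (swapped s σ)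
            ≡⟨ cong₂ _+_ (trans (∑-const (permutations n) k) (*-comm p k)) (∑-comm (permutations n) swaps _) ⟩
          k * p + ∑[ s ∈ swaps ] ∑[ σ ∈ permutations n ] χ (swapped s σ)
            ≤⟨ +-monoʳ-≤ (k * p) (∑-mono swaps (λ {(i , j)} _ → ∑-swapped i j χ)) ⟩
          k * p + ∑[ s ∈ swaps ] ∑ (permutations n) χ
            ≡⟨ cong (k * p +_) (trans (∑-const swaps _) (cong₂ _*_ length-swaps (∑-comm (permutations n) (sublists K xs) _))) ⟩
          k * p + n * n * m       ≤⟨ +-monoʳ-≤ (k * p) rare ⟩
          k * p + p               ≡⟨ +-comm (k * p) p ⟩
          K * p                   ∎
          where
          open ≤-Reasoning
          m : ℕ
          m = ∑[ ts ∈ sublists K xs ] count (allGood? ts)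
          swaps : List (Fin n × Fin n)
          swaps = cartesianProduct (allFin n) (allFin n)
          length-swaps : length swaps ≡ n * n
          length-swaps = trans (length-cartesianProduct (allFin n) (allFin n)) (cong (λ z → z * z) (length-tabulate {n = n} id))
          χ : Contents n → ℕ
          χ τ = ∑[ ts ∈ sublists K xs ] 𝟙 (allGood? ts τ)
          over-swaps : ∀ σ → χ (afterAlice S σ) ≤ ∑[ s ∈ swaps ] χ (swapped s σ)
          over-swaps σ = term (λ s → χ (swapped s σ)) (∈-cartesianProduct⁺ (∈-allFin _) (∈-allFin _))
            where
            term : ∀ {x xs} (f : Fin n × Fin n → ℕ) → x ∈ xs → f x ≤ ∑ xs f
            term f (here refl) = m≤m+n _ _
            term f (there x∈)  = ≤-trans (term f x∈) (m≤n+m _ _)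
          -- Summed over all swaps, the expected number of good `K`-sublists is at most 1; this
          -- raises the `k` of `count≤sublists` to `K`.
          rare : n * n * m ≤ p
          rare = *-cancelʳ-≤ (n * n * m) p (K !) {{K !≢0}} (begin
            n * n * m * K !       ≡⟨ *-assoc (n * n) m (K !) ⟩
            n * n * (m * K !)     ≤⟨ *-monoʳ-≤ (n * n) sublists-bound ⟩
            n * n * (4 ^ K * p)   ≡⟨ *-assoc (n * n) (4 ^ K) p ⟨
            n * n * 4 ^ K * p     ≤⟨ *-monoˡ-≤ p small ⟩
            K ! * p               ≡⟨ *-comm (K !) p ⟩
            p * K !               ∎)

    -- Splitting Bob's successes into ascending and descending ones.

    module Ascending  = Class (λ t c → t Fin.≤ c) _≤ꟳ?_
    module Descending = Class (λ t c → c Fin.< t) (λ t c → c <ꟳ? t)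

    -- For the descending class `t ▷ u` amounts to `u < t`, so a chain has to list the labels in
    -- decreasing order. For the ascending class it amounts to `t < u`, and `allFin n` serves.
    descending : List (Fin n)
    descending = List.tabulate Fin.opposite

    ascending-chain : AllPairs Ascending._▷_ (allFin n)
    ascending-chain = tabulate⁺-< (λ t<u → <ꟳ⇒≢ t<u , <⇒≱ t<u)

    descending-chain : AllPairs Descending._▷_ descending
    descending-chain = tabulate⁺-< (λ i<j → (λ eq → <ꟳ⇒≢ (reversed i<j) (sym eq)) , <⇒≯ (reversed i<j))
      where
      reversed : ∀ {i j : Fin n} → i Fin.< j → Fin.opposite j Fin.< Fin.opposite i
      reversed {i} {j} i<j = subst₂ _<_ (sym (opposite-prop j)) (sym (opposite-prop i)) (∸-monoʳ-< (s≤s i<j) (toℕ<n j))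

    ∑-descending : ∀ f → ∑ (allFin n) f ≤ ∑ descending f
    ∑-descending f = ∑-injection id f (Uᴸ.allFin⁺ n) (λ _ _ eq → eq)
      (λ {t} _ → subst (_∈ descending) (opposite-involutive t) (∈-tabulate⁺ (Fin.opposite t)))

    -- The card in the first locker is either at least `t` or below it; a label found in its first
    -- locker counts as ascending.
    success-split : ∀ σ t → 𝟙 (bobSucceeds? S (σ , t)) ≤
                    𝟙 (Ascending.good? (afterAlice S σ) t) + 𝟙 (Descending.good? (afterAlice S σ) t)
    success-split σ t = 𝟙-⊎ (bobSucceeds? S (σ , t)) (Ascending.good? τ t) (Descending.good? τ t) classify
      where
      τ = afterAlice S σ
      classify : BobSucceeds S (σ , t) → Ascending.Good τ t ⊎ Descending.Good τ t
      classify found with t ≤ꟳ? lookup τ (first t)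
      ... | yes t≤c = inj₁ (t≤c , found-locate τ t found)
      ... | no  t≰c = inj₂ (≰⇒> t≰c , found-locate τ t found)

    -- Each of the two classes contributes at most K found labels on average, which gives success
    -- probability at most 2K / n; denominators are cleared.
    successes-bound : ∀ k → 4 * suc k ≤ n → n * n * 4 ^ suc k ≤ suc k ! →
                      length (filter (bobSucceeds? S) (Outcomes n)) * n ≤ 2 * suc k * length (Outcomes n)
    successes-bound k 4K≤n small = begin
      length (filter (bobSucceeds? S) (Outcomes n)) * n
        ≡⟨ cong (_* n) (trans (length-filter-∑ (bobSucceeds? S) (Outcomes n)) (∑-cartesianProduct (permutations n) (allFin n) _)) ⟩
      (∑[ σ ∈ permutations n ] ∑[ t ∈ allFin n ] 𝟙 (bobSucceeds? S (σ , t))) * n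
        ≤⟨ *-monoˡ-≤ n (∑-mono (permutations n) (λ {σ} _ → split σ)) ⟩
      (∑[ σ ∈ permutations n ] (∑[ t ∈ allFin n ] asc σ t + ∑[ t ∈ descending ] desc σ t)) * n
        ≡⟨ cong (_* n) (∑-+ (permutations n) _ _) ⟩
      (∑[ σ ∈ permutations n ] ∑[ t ∈ allFin n ] asc σ t + ∑[ σ ∈ permutations n ] ∑[ t ∈ descending ] desc σ t) * n
        ≤⟨ *-monoˡ-≤ n (+-mono-≤
             (Ascending.swaps-bound ascending-chain (length-tabulate id) k 4K≤n small)
             (Descending.swaps-bound descending-chain (length-tabulate Fin.opposite) k 4K≤n small)) ⟩
      (suc k * p + suc k * p) * n      ≡⟨ identity (suc k) p n ⟩
      2 * suc k * (p * n)              ≡⟨ cong (2 * suc k *_) length-outcomes ⟨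
      2 * suc k * length (Outcomes n)  ∎
      where
      open ≤-Reasoning
      p = length (permutations n)
      asc desc : Contents n → Fin n → ℕ
      asc σ t  = 𝟙 (Ascending.good? (afterAlice S σ) t)
      desc σ t = 𝟙 (Descending.good? (afterAlice S σ) t)
      split : ∀ σ → ∑[ t ∈ allFin n ] 𝟙 (bobSucceeds? S (σ , t)) ≤ ∑[ t ∈ allFin n ] asc σ t + ∑[ t ∈ descending ] desc σ t
      split σ = ≤-trans (∑-mono (allFin n) (λ {t} _ → success-split σ t))
        (≤-trans (≤-reflexive (∑-+ (allFin n) _ _)) (+-monoʳ-≤ _ (∑-descending (desc σ))))
      length-outcomes : length (Outcomes n) ≡ p * n
      length-outcomes = trans (length-cartesianProduct (permutations n) (allFin n)) (cong (p *_) (length-tabulate {n = n} id))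
      identity : ∀ k p n → (k * p + k * p) * n ≡ 2 * k * (p * n)
      identity = solve-∀

-- Integer estimates for logarithms, powers and factorials.

module Asymptotics where

  open import Data.Nat.Base
  open import Data.Nat.Properties
  open import Data.Nat.DivMod using (m≡m%n+[m/n]*n; m%n<n; m/n*n≤m)
  open import Data.Nat.Induction using (<-rec)
  open import Data.Nat.Logarithm
  open import Data.Nat.Tactic.RingSolver using (solve-∀)
  open import Data.Product.Base using (∃-syntax; _×_; _,_)
  open import Data.Sum.Base using (inj₁; inj₂)
  open import Relation.Binary.PropositionalEquality

  2*⌊n/2⌋≤n : ∀ n → 2 * ⌊ n /2⌋ ≤ n
  2*⌊n/2⌋≤n n = begin
    2 * ⌊ n /2⌋            ≡⟨ cong (⌊ n /2⌋ +_) (+-identityʳ ⌊ n /2⌋) ⟩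
    ⌊ n /2⌋ + ⌊ n /2⌋      ≤⟨ +-monoʳ-≤ ⌊ n /2⌋ (⌊n/2⌋≤⌈n/2⌉ n) ⟩
    ⌊ n /2⌋ + ⌈ n /2⌉      ≡⟨ ⌊n/2⌋+⌈n/2⌉≡n n ⟩
    n                      ∎
    where open ≤-Reasoning

  2^⌊log₂n⌋≤n : ∀ n .{{_ : NonZero n}} → 2 ^ ⌊log₂ n ⌋ ≤ n
  2^⌊log₂n⌋≤n = <-rec (λ n → .{{_ : NonZero n}} → 2 ^ ⌊log₂ n ⌋ ≤ n) step
    where
    step : ∀ n → (∀ {m} → m < n → .{{_ : NonZero m}} → 2 ^ ⌊log₂ m ⌋ ≤ m) → .{{_ : NonZero n}} → 2 ^ ⌊log₂ n ⌋ ≤ n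
    step 1 rec = ≤-refl
    step n@(suc (suc n′)) rec = begin
      2 ^ ⌊log₂ n ⌋                      ≤⟨ ^-monoʳ-≤ 2 {x = ⌊log₂ n ⌋} {y = suc (⌊log₂ n ⌋ ∸ 1)} (m≤n+m∸n ⌊log₂ n ⌋ 1) ⟩
      2 * 2 ^ (⌊log₂ n ⌋ ∸ 1)            ≡⟨ cong (λ l → 2 * 2 ^ l) (⌊log₂⌊n/2⌋⌋≡⌊log₂n⌋∸1 n) ⟨
      2 * 2 ^ ⌊log₂ ⌊ n /2⌋ ⌋            ≤⟨ *-monoʳ-≤ 2 (rec (⌊n/2⌋<n (suc n′))) ⟩
      2 * ⌊ n /2⌋                        ≤⟨ 2*⌊n/2⌋≤n n ⟩
      n                                  ∎
      where open ≤-Reasoning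

  n<2^[1+⌊log₂n⌋] : ∀ n → n < 2 ^ suc ⌊log₂ n ⌋
  n<2^[1+⌊log₂n⌋] n = ≰⇒> λ 2^≤n → 1+n≰n
    (≤-trans (≤-reflexive (sym (⌊log₂[2^n]⌋≡n (suc ⌊log₂ n ⌋)))) (⌊log₂⌋-mono-≤ 2^≤n))

  2^≤⇒≤⌊log₂⌋ : ∀ {m n} → 2 ^ m ≤ n → m ≤ ⌊log₂ n ⌋
  2^≤⇒≤⌊log₂⌋ {m} 2^m≤n = ≤-trans (≤-reflexive (sym (⌊log₂[2^n]⌋≡n m))) (⌊log₂⌋-mono-≤ 2^m≤n)

  n<2^n : ∀ n → n < 2 ^ n
  n<2^n zero    = s≤s z≤n
  n<2^n (suc n) = begin-strict
    suc n              <⟨ +-mono-≤-< (m^n>0 2 n) (n<2^n n) ⟩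
    2 ^ n + 2 ^ n      ≡⟨ cong (2 ^ n +_) (+-identityʳ (2 ^ n)) ⟨
    2 ^ suc n          ∎
    where open ≤-Reasoning

  -- The last n - m factors of the factorial are all larger than `m`. For `n < m` the truncated
  -- exponent is 0.
  m^[n∸m]≤n! : ∀ m n → m ^ (n ∸ m) ≤ n !
  m^[n∸m]≤n! m zero    = ≤-reflexive (cong (m ^_) (0∸n≡0 m))
  m^[n∸m]≤n! m (suc n) with ≤-<-connex m n
  ... | inj₁ m≤n rewrite +-∸-assoc 1 m≤n = *-mono-≤ (m≤n⇒m≤1+n m≤n) (m^[n∸m]≤n! m n)
  ... | inj₂ n<m rewrite m≤n⇒m∸n≡0 n<m = n≢0⇒n>0 (≢-nonZero⁻¹ (suc n !) {{suc n !≢0}})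

  -- Since `2 ^ d ≤ b`, this makes `e = b ∸ (2 * d + 2)` at least `(d + 1) * g`. The threshold 8 is
  -- sharp: 189 ≤ 256 there, whereas 7 would require 152 ≤ 128.
  2^-beats-quadratic : ∀ d → 8 ≤ d → (d + 1) * (2 * d + 3) + (2 * d + 2) ≤ 2 ^ d
  2^-beats-quadratic d 8≤d with m≤n⇒∃[o]m+o≡n 8≤d
  ... | j , refl = go j
    where
    open ≤-Reasoning
    go : ∀ j → (8 + j + 1) * (2 * (8 + j) + 3) + (2 * (8 + j) + 2) ≤ 2 ^ (8 + j)
    go zero    = ≤ᵇ⇒≤ 189 256 _
    go (suc j) = begin
      (8 + suc j + 1) * (2 * (8 + suc j) + 3) + (2 * (8 + suc j) + 2)  ≤⟨ m≤m+n _ (2 * (j * j) + 35 * j + 148) ⟩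
      (8 + suc j + 1) * (2 * (8 + suc j) + 3) + (2 * (8 + suc j) + 2) + (2 * (j * j) + 35 * j + 148) ≡⟨ identity j ⟩
      2 * ((8 + j + 1) * (2 * (8 + j) + 3) + (2 * (8 + j) + 2))        ≤⟨ *-monoʳ-≤ 2 (go j) ⟩
      2 * 2 ^ (8 + j)                                                  ≡⟨ cong (2 ^_) (+-suc 8 j) ⟨
      2 ^ (8 + suc j)                                                  ∎
      where
      identity : ∀ j → (8 + (1 + j) + 1) * (2 * (8 + (1 + j)) + 3) + (2 * (8 + (1 + j)) + 2) + (2 * (j * j) + 35 * j + 148)
               ≡ 2 * ((8 + j + 1) * (2 * (8 + j) + 3) + (2 * (8 + j) + 2))
      identity = solve-∀

  -- Leads from `4 * suc k ≤ 3 * a` to `4 * suc k ≤ n` by way of `2 ^ a ≤ n`.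
  3a≤2^a : ∀ a → 4 ≤ a → 3 * a ≤ 2 ^ a
  3a≤2^a a 4≤a with m≤n⇒∃[o]m+o≡n 4≤a
  ... | j , refl = go j
    where
    open ≤-Reasoning
    go : ∀ j → 3 * (4 + j) ≤ 2 ^ (4 + j)
    go zero    = ≤ᵇ⇒≤ 12 16 _
    go (suc j) = begin
      3 * (4 + suc j)               ≤⟨ m≤m+n _ (9 + 3 * j) ⟩
      3 * (4 + suc j) + (9 + 3 * j) ≡⟨ identity j ⟩
      2 * (3 * (4 + j))             ≤⟨ *-monoʳ-≤ 2 (go j) ⟩
      2 * 2 ^ (4 + j)               ∎
      where
      identity : ∀ j → 3 * (4 + (1 + j)) + (9 + 3 * j) ≡ 2 * (3 * (4 + j))
      identity = solve-∀

  -- Choice of K; `a`, `b`, `d` stand for the integer parts of log n and its second and third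
  -- iterates.

  module _ {n a b d : ℕ} (2^a≤n : 2 ^ a ≤ n) (n<2^[1+a] : n < 2 ^ suc a) (2^b≤a : 2 ^ b ≤ a)
           (2^d≤b : 2 ^ d ≤ b) (b<2^[1+d] : b < 2 ^ suc d) (8≤d : 8 ≤ d) where

    -- By K! ≥ (2^c)^(K - 2^c), the inequality n² 4^K ≤ K! follows from
    -- c (K - 2^c) ≥ 2 (a + 1) + 2 K, that is, from e K ≥ r.  The choice
    -- c = b - 2d makes c asymptotic to log log n while c 2^c is o(a).

    private
      D g e c r : ℕ
      -- `D` approximates `b` within a factor 2, and `g` is the gap in `b + 1 = e + g`. The 2 in
      -- `c = e + 2` pays for `4 ^ K`, which takes `2 * K` out of the exponent `c * K`.
      D = 2 ^ d
      g = 2 * d + 3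
      e = b ∸ (2 * d + 2)
      c = e + 2
      r = 2 * a + 2 + c * 2 ^ c

      b≡ : b ≡ e + (2 * d + 2)
      b≡ = sym (m∸n+n≡m (≤-trans (m≤n+m (2 * d + 2) ((d + 1) * g)) (≤-trans (2^-beats-quadratic d 8≤d) 2^d≤b)))

      dg≤e : (d + 1) * g ≤ e
      dg≤e = m+n≤o⇒m≤o∸n _ (≤-trans (2^-beats-quadratic d 8≤d) 2^d≤b)

      d≤D : d + 1 ≤ D
      d≤D = ≤-trans (≤-reflexive (+-comm d 1)) (n<2^n d)

      4≤D : 4 ≤ D
      4≤D = ^-monoʳ-≤ 2 {x = 2} {y = d} (≤-trans (≤ᵇ⇒≤ 2 8 _) 8≤d)

      4≤e : 4 ≤ e
      4≤e = ≤-trans (≤-trans (≤ᵇ⇒≤ 4 24 _) (*-mono-≤ (m≤n⇒m≤n+o 1 8≤d) (m≤n+m 3 (2 * d)))) dg≤e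

      4≤a : 4 ≤ a
      4≤a = ≤-trans 4≤D (≤-trans 2^d≤b (≤-trans (<⇒≤ (n<2^n b)) 2^b≤a))

      instance
        e-nonZero : NonZero e
        e-nonZero = >-nonZero (≤-trans (s≤s z≤n) 4≤e)

      -- Taking one more than the quotient secures `r ≤ suc k * e` and overshoots `r` by at most
      -- `e`.
      k : ℕ
      k = r / e

      -- As b = c + 2d, the product `2 ^ c * (D * D)` is `2 ^ b`, at most `a`; and `c ≤ b ≤ 2 * D`.
      -- So c 2^c is smaller than `a` by a factor of order `D`.
      c2^cD≤2a : c * 2 ^ c * D ≤ 2 * a
      c2^cD≤2a = begin
        c * 2 ^ c * D            ≤⟨ *-monoˡ-≤ D (*-monoˡ-≤ (2 ^ c) c≤2D) ⟩
        2 * D * 2 ^ c * D        ≡⟨ rearrange D (2 ^ c) ⟩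
        2 * (2 ^ c * (D * D))    ≡⟨ cong (2 *_) 2^b≡ ⟨
        2 * 2 ^ b                ≤⟨ *-monoʳ-≤ 2 2^b≤a ⟩
        2 * a                    ∎
        where
        open ≤-Reasoning
        exponent : ∀ e d → e + (2 * d + 2) ≡ e + 2 + (d + d)
        exponent = solve-∀
        c≤2D : c ≤ 2 * D
        c≤2D = ≤-trans (m≤m+n c (d + d)) (≤-trans (≤-reflexive (trans (sym (exponent e d)) (sym b≡))) (<⇒≤ b<2^[1+d]))
        2^b≡ : 2 ^ b ≡ 2 ^ c * (D * D)
        2^b≡ = trans (cong (2 ^_) (trans b≡ (exponent e d)))
          (trans (^-distribˡ-+-* 2 c (d + d)) (cong (2 ^ c *_) (^-distribˡ-+-* 2 d d)))
        rearrange : ∀ x y → 2 * x * y * x ≡ 2 * (y * (x * x))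
        rearrange = solve-∀

      r≤Ke : r ≤ suc k * e
      r≤Ke = begin
        r               ≡⟨ m≡m%n+[m/n]*n r e ⟩
        r % e + k * e   ≤⟨ +-monoˡ-≤ (k * e) (<⇒≤ (m%n<n r e)) ⟩
        suc k * e       ∎
        where open ≤-Reasoning

      -- The main term `2 * a` comes from n². The rounding `e` and the constant 2 add up to `c`, so
      -- they and `c * 2 ^ c` cost at most `2 * a` each after multiplication by `D`.
      KeD≤ : suc k * e * D ≤ a * (2 * D + 4)
      KeD≤ = begin
        (e + k * e) * D                        ≤⟨ *-monoˡ-≤ D (+-monoʳ-≤ e (m/n*n≤m r e)) ⟩
        (e + (2 * a + 2 + c * 2 ^ c)) * D      ≡⟨ rearrange e a (c * 2 ^ c) D ⟩
        2 * a * D + c * D + c * 2 ^ c * D      ≤⟨ +-mono-≤ (+-monoʳ-≤ (2 * a * D) (≤-trans (*-monoˡ-≤ D c≤c2^c) c2^cD≤2a)) c2^cD≤2a ⟩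
        2 * a * D + 2 * a + 2 * a              ≡⟨ collect a D ⟩
        a * (2 * D + 4)                        ∎
        where
        open ≤-Reasoning
        c≤c2^c : c ≤ c * 2 ^ c
        c≤c2^c = m≤m*n c (2 ^ c) {{m^n≢0 2 c}}
        rearrange : ∀ e a x D → (e + (2 * a + 2 + x)) * D ≡ 2 * a * D + (e + 2) * D + x * D
        rearrange = solve-∀
        collect : ∀ a D → 2 * a * D + 2 * a + 2 * a ≡ a * (2 * D + 4)
        collect = solve-∀

      4K≤n : 4 * suc k ≤ n
      4K≤n = ≤-trans (*-cancelʳ-≤ (4 * suc k) (3 * a) D {{m^n≢0 2 d}} (begin
        4 * suc k * D        ≤⟨ *-monoˡ-≤ D (≤-trans (*-monoˡ-≤ (suc k) 4≤e) (≤-reflexive (*-comm e (suc k)))) ⟩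
        suc k * e * D        ≤⟨ KeD≤ ⟩
        a * (2 * D + 4)      ≤⟨ *-monoʳ-≤ a (+-monoʳ-≤ (2 * D) 4≤D) ⟩
        a * (2 * D + D)      ≡⟨ collect a D ⟩
        3 * a * D            ∎)) (≤-trans (3a≤2^a a 4≤a) 2^a≤n)
        where
        open ≤-Reasoning
        collect : ∀ a D → a * (2 * D + D) ≡ 3 * a * D
        collect = solve-∀

      small : n * n * 4 ^ suc k ≤ suc k !
      small = begin
        n * n * 4 ^ suc k                                ≤⟨ *-monoˡ-≤ (4 ^ suc k) (*-mono-≤ (<⇒≤ n<2^[1+a]) (<⇒≤ n<2^[1+a])) ⟩
        2 ^ suc a * 2 ^ suc a * (2 ^ 2) ^ suc k          ≡⟨ cong₂ _*_ (sym (^-distribˡ-+-* 2 (suc a) (suc a))) (^-*-assoc 2 2 (suc k)) ⟩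
        2 ^ (suc a + suc a) * 2 ^ (2 * suc k)            ≡⟨ ^-distribˡ-+-* 2 (suc a + suc a) (2 * suc k) ⟨
        2 ^ (suc a + suc a + 2 * suc k)                  ≤⟨ ^-monoʳ-≤ 2 exponents ⟩
        2 ^ (c * (suc k ∸ 2 ^ c))                        ≡⟨ ^-*-assoc 2 c (suc k ∸ 2 ^ c) ⟨
        (2 ^ c) ^ (suc k ∸ 2 ^ c)                        ≤⟨ m^[n∸m]≤n! (2 ^ c) (suc k) ⟩
        suc k !                                          ∎
        where
        open ≤-Reasoning
        rearrange : ∀ a K x → 1 + a + (1 + a) + 2 * K + x ≡ 2 * a + 2 + x + 2 * K
        rearrange = solve-∀
        collect : ∀ K e → K * e + 2 * K ≡ (e + 2) * K
        collect = solve-∀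
        exponents : suc a + suc a + 2 * suc k ≤ c * (suc k ∸ 2 ^ c)
        exponents = begin
          suc a + suc a + 2 * suc k    ≤⟨ m+n≤o⇒m≤o∸n _ (begin
            suc a + suc a + 2 * suc k + c * 2 ^ c    ≡⟨ rearrange a (suc k) (c * 2 ^ c) ⟩
            r + 2 * suc k                            ≤⟨ +-monoˡ-≤ (2 * suc k) r≤Ke ⟩
            suc k * e + 2 * suc k                    ≡⟨ collect (suc k) e ⟩
            c * suc k                                ∎) ⟩
          c * suc k ∸ c * 2 ^ c        ≡⟨ *-distribˡ-∸ c (suc k) (2 ^ c) ⟨
          c * (suc k ∸ 2 ^ c)          ∎

      -- By `KeD≤`, the left side divided by (d + 1) a is at most 2 (1 + g / e) (2 + 4 / D), whose
      -- leading term is 4. Because `(d + 1) * g ≤ e` and `d + 1 ≤ D`, the three other terms are at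
      -- most 8, 4 and 8 over d + 1, whence the 20.
      main : 2 * suc k * (b + 1) * (d + 1) ≤ (4 * (d + 1) + 20) * a
      main = *-cancelʳ-≤ _ _ (e * D) {{m*n≢0 e D {{e-nonZero}} {{m^n≢0 2 d}}}} (begin
        2 * suc k * (b + 1) * (d + 1) * (e * D)            ≡⟨ cong (λ b → 2 * suc k * (b + 1) * (d + 1) * (e * D)) b≡ ⟩
        2 * suc k * (e + (2 * d + 2) + 1) * (d + 1) * (e * D) ≡⟨ rearrange (suc k) e d D ⟩
        2 * (e + g) * (d + 1) * (suc k * e * D)            ≤⟨ *-monoʳ-≤ (2 * (e + g) * (d + 1)) KeD≤ ⟩
        2 * (e + g) * (d + 1) * (a * (2 * D + 4))          ≡⟨ expand e g (d + 1) a D ⟩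
        a * (4 * (d + 1) * (e * D) + 8 * (e * (d + 1)) + 4 * ((d + 1) * g * D) + 8 * ((d + 1) * g))
          ≤⟨ *-monoʳ-≤ a (+-mono-≤ (+-mono-≤ (+-monoʳ-≤ (4 * (d + 1) * (e * D)) (*-monoʳ-≤ 8 (*-monoʳ-≤ e d≤D)))
               (*-monoʳ-≤ 4 (*-monoˡ-≤ D dg≤e))) (*-monoʳ-≤ 8 (≤-trans dg≤e (m≤m*n e D {{m^n≢0 2 d}})))) ⟩
        a * (4 * (d + 1) * (e * D) + 8 * (e * D) + 4 * (e * D) + 8 * (e * D))  ≡⟨ collect a (d + 1) (e * D) ⟩
        (4 * (d + 1) + 20) * a * (e * D)                   ∎)
        where
        open ≤-Reasoning
        rearrange : ∀ K e d D → 2 * K * (e + (2 * d + 2) + 1) * (d + 1) * (e * D) ≡ 2 * (e + (2 * d + 3)) * (d + 1) * (K * e * D)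
        rearrange = solve-∀
        expand : ∀ e g f a D → 2 * (e + g) * f * (a * (2 * D + 4)) ≡ a * (4 * f * (e * D) + 8 * (e * f) + 4 * (f * g * D) + 8 * (f * g))
        expand = solve-∀
        collect : ∀ a f x → a * (4 * f * x + 8 * x + 4 * x + 8 * x) ≡ (4 * f + 20) * a * x
        collect = solve-∀

    threshold : ∃[ k ] 4 * suc k ≤ n × n * n * 4 ^ suc k ≤ suc k ! × 2 * suc k * (b + 1) * (d + 1) ≤ (4 * (d + 1) + 20) * a
    threshold = k , 4K≤n , small , main

open import Defs
open import Data.Nat.Base using (ℕ; NonZero; _≤_)
open import Data.Product.Base using (Σ-syntax; _×_)
open import Data.Rational.Base using (ℚ; _+_)
open import Data.Bool.Base using (if_then_else_)
open import Data.List.Base using (length; filter)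
open import Data.List.Properties using (length-filter)
open import Data.Integer.Base as ℤ using (ℤ; +_; -[1+_]; +≤+; -≤+)
import Data.Integer.Properties as ℤ
open import Data.Nat.Base as ℕ using (zero; suc; s≤s; z≤n)
import Data.Nat.Properties as ℕ
open import Data.Nat.Coprimality using (Coprime)
open import Data.Nat.Logarithm using (⌊log₂_⌋)
open import Data.Nat.Tactic.RingSolver using (solve-∀)
open import Data.Product.Base using (∃-syntax; _,_; map₂)
open import Data.Sum.Base using (inj₁; inj₂)
open import Data.Rational.Base as ℚ using (mkℚ; _*_; 0ℚ; 1ℚ; ½; ↥_; ↧ₙ_; _/_; toℚᵘ; nonNegative; positive; *≤*; *<*)
import Data.Rational.Properties as ℚ
open import Data.Rational.Unnormalised.Base as ℚᵘ using (mkℚᵘ)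
import Data.Rational.Unnormalised.Properties as ℚᵘ
open import Relation.Binary.PropositionalEquality
open import Relation.Nullary using (Dec; yes; no; does; contradiction)
open import Relation.Nullary.Decidable using (dec-true)

open Counting using (successes-bound)
open Asymptotics using (2^⌊log₂n⌋≤n; n<2^[1+⌊log₂n⌋]; 2^≤⇒≤⌊log₂⌋; threshold)

-- From natural numbers to rationals.

toℚᵘ-/ : ∀ i d → toℚᵘ (i / suc d) ℚᵘ.≃ mkℚᵘ i d
toℚᵘ-/ i d = ℚ.toℚᵘ-fromℚᵘ (mkℚᵘ i d)

-- Quotients are compared through unnormalised representatives, where reduction to lowest terms does
-- not interfere with cross-multiplication.
≤-viaᵘ : ∀ {x y u v} → toℚᵘ x ℚᵘ.≃ u → toℚᵘ y ℚᵘ.≃ v → u ℚᵘ.≤ v → x ℚ.≤ y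
≤-viaᵘ x≃u y≃v u≤v = ℚ.toℚᵘ-cancel-≤
  (ℚᵘ.≤-respˡ-≃ (ℚᵘ.≃-sym x≃u) (ℚᵘ.≤-respʳ-≃ (ℚᵘ.≃-sym y≃v) u≤v))

fromℕ-* : ∀ m n → fromℕ (m ℕ.* n) ≡ fromℕ m * fromℕ n
fromℕ-* m n = ℚ.toℚᵘ-injective (ℚᵘ.≃-trans (toℚᵘ-/ (+ (m ℕ.* n)) 0)
  (ℚᵘ.≃-trans (ℚᵘ.*≡* (cong (ℤ._* + 1) (ℤ.pos-* m n)))
    (ℚᵘ.≃-sym (ℚᵘ.≃-trans (ℚ.toℚᵘ-homo-* (fromℕ m) (fromℕ n)) (ℚᵘ.*-cong (toℚᵘ-/ (+ m) 0) (toℚᵘ-/ (+ n) 0))))))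

fromℕ-mono-≤ : ∀ {m n} → m ≤ n → fromℕ m ℚ.≤ fromℕ n
fromℕ-mono-≤ {m} {n} m≤n = ≤-viaᵘ (toℚᵘ-/ (+ m) 0) (toℚᵘ-/ (+ n) 0)
  (ℚᵘ.*≤* (ℤ.*-monoʳ-≤-nonNeg (+ 1) (+≤+ m≤n)))

0≤fromℕ : ∀ n → 0ℚ ℚ.≤ fromℕ n
0≤fromℕ n = fromℕ-mono-≤ {0} {n} z≤n

0≤/ : ∀ x y → 0ℚ ℚ.≤ + x / suc y
0≤/ x y = ℚ.nonNegative⁻¹ _ {{ℚ.normalize-nonNeg x (suc y)}}

0<fromℕ : ∀ n .{{_ : NonZero n}} → 0ℚ ℚ.< fromℕ n
0<fromℕ n = ℚ.positive⁻¹ _ {{ℚ.normalize-pos n 1}}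

fraction-bound : ∀ F O .{{_ : NonZero O}} m x y a →
  F ℕ.* m ℕ.* suc y ≤ (4 ℕ.* suc y ℕ.+ x) ℕ.* a ℕ.* O →
  (+ F / O) * fromℕ m ℚ.≤ (fromℕ 4 + + x / suc y) * fromℕ a
fraction-bound F (suc o) m x y a le = ≤-viaᵘ lhs rhs (ℚᵘ.*≤* (subst₂ ℤ._≤_ left right (+≤+ le′)))
  where
  lhs : toℚᵘ ((+ F / suc o) * fromℕ m) ℚᵘ.≃ mkℚᵘ (+ F) o ℚᵘ.* mkℚᵘ (+ m) 0
  lhs = ℚᵘ.≃-trans (ℚ.toℚᵘ-homo-* (+ F / suc o) (fromℕ m)) (ℚᵘ.*-cong (toℚᵘ-/ (+ F) o) (toℚᵘ-/ (+ m) 0))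
  rhs : toℚᵘ ((fromℕ 4 + + x / suc y) * fromℕ a) ℚᵘ.≃ (mkℚᵘ (+ 4) 0 ℚᵘ.+ mkℚᵘ (+ x) y) ℚᵘ.* mkℚᵘ (+ a) 0
  rhs = ℚᵘ.≃-trans (ℚ.toℚᵘ-homo-* (fromℕ 4 + + x / suc y) (fromℕ a))
    (ℚᵘ.*-cong (ℚᵘ.≃-trans (ℚ.toℚᵘ-homo-+ (fromℕ 4) (+ x / suc y)) (ℚᵘ.+-cong (toℚᵘ-/ (+ 4) 0) (toℚᵘ-/ (+ x) y)))
      (toℚᵘ-/ (+ a) 0))
  -- The factors 1 are the denominators of the embedded naturals, placed as unnormalised arithmetic
  -- produces them.
  le′ : F ℕ.* m ℕ.* (1 ℕ.* suc y ℕ.* 1) ≤ (4 ℕ.* suc y ℕ.+ x ℕ.* 1) ℕ.* a ℕ.* (suc o ℕ.* 1)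
  le′ = subst₂ _≤_ (e₁ (F ℕ.* m) y) (e₂ x y a o) le
    where
    e₁ : ∀ f y → f ℕ.* (1 ℕ.+ y) ≡ f ℕ.* (1 ℕ.* (1 ℕ.+ y) ℕ.* 1)
    e₁ = solve-∀
    e₂ : ∀ x y a o → (4 ℕ.* (1 ℕ.+ y) ℕ.+ x) ℕ.* a ℕ.* (1 ℕ.+ o) ≡ (4 ℕ.* (1 ℕ.+ y) ℕ.+ x ℕ.* 1) ℕ.* a ℕ.* ((1 ℕ.+ o) ℕ.* 1)
    e₂ = solve-∀
  left : + (F ℕ.* m ℕ.* (1 ℕ.* suc y ℕ.* 1)) ≡ + F ℤ.* + m ℤ.* + (1 ℕ.* suc y ℕ.* 1)
  left = trans (ℤ.pos-* (F ℕ.* m) _) (cong (ℤ._* + (1 ℕ.* suc y ℕ.* 1)) (ℤ.pos-* F m))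
  right : + ((4 ℕ.* suc y ℕ.+ x ℕ.* 1) ℕ.* a ℕ.* (suc o ℕ.* 1)) ≡ (+ 4 ℤ.* + suc y ℤ.+ + x ℤ.* + 1) ℤ.* + a ℤ.* + (suc o ℕ.* 1)
  right = trans (ℤ.pos-* ((4 ℕ.* suc y ℕ.+ x ℕ.* 1) ℕ.* a) _) (cong (ℤ._* + (suc o ℕ.* 1))
    (trans (ℤ.pos-* (4 ℕ.* suc y ℕ.+ x ℕ.* 1) a) (cong (ℤ._* + a)
      (cong₂ ℤ._+_ (ℤ.pos-* 4 (suc y)) (ℤ.pos-* x 1)))))

*-mono-≤-nonNeg : ∀ {a b c d} → 0ℚ ℚ.≤ a → 0ℚ ℚ.≤ c → a ℚ.≤ b → c ℚ.≤ d → a * c ℚ.≤ b * d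
*-mono-≤-nonNeg {a} {b} {c} {d} 0≤a 0≤c a≤b c≤d = ℚ.≤-trans
  (ℚ.*-monoʳ-≤-nonNeg c {{nonNegative 0≤c}} a≤b)
  (ℚ.*-monoˡ-≤-nonNeg b {{nonNegative (ℚ.≤-trans 0≤a a≤b)}} c≤d)

*-nonNeg : ∀ {a b} → 0ℚ ℚ.≤ a → 0ℚ ℚ.≤ b → 0ℚ ℚ.≤ a * b
*-nonNeg 0≤a 0≤b = *-mono-≤-nonNeg ℚ.≤-refl ℚ.≤-refl 0≤a 0≤b

pow-nonNeg : ∀ {x} k → 0ℚ ℚ.≤ x → 0ℚ ℚ.≤ pow x k
pow-nonNeg zero    0≤x = 0≤fromℕ 1
pow-nonNeg (suc k) 0≤x = *-nonNeg 0≤x (pow-nonNeg k 0≤x)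

pow-mono : ∀ {x y} k → 0ℚ ℚ.≤ x → x ℚ.≤ y → pow x k ℚ.≤ pow y k
pow-mono zero    0≤x x≤y = ℚ.≤-refl
pow-mono (suc k) 0≤x x≤y = *-mono-≤-nonNeg 0≤x (pow-nonNeg k 0≤x) x≤y (pow-mono k 0≤x x≤y)

pow-fromℕ : ∀ m k → pow (fromℕ m) k ≡ fromℕ (m ℕ.^ k)
pow-fromℕ m zero    = refl
pow-fromℕ m (suc k) = trans (cong (fromℕ m *_) (pow-fromℕ m k)) (sym (fromℕ-* m (m ℕ.^ k)))

pow-2^ : ∀ m k → pow (fromℕ (2 ℕ.^ m)) k ≡ fromℕ (2 ℕ.^ (m ℕ.* k))
pow-2^ m k = trans (pow-fromℕ (2 ℕ.^ m) k) (cong fromℕ (ℕ.^-*-assoc 2 m k))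

2^-upper : ∀ {z m} → z ℤ.≤ + m → 2^ z ℚ.≤ fromℕ (2 ℕ.^ m)
2^-upper {+ k} {m} (+≤+ k≤m) = ℚ.≤-trans (ℚ.≤-reflexive (pow-fromℕ 2 k)) (fromℕ-mono-≤ (ℕ.^-monoʳ-≤ 2 k≤m))
2^-upper { -[1+ k ]} {m} -≤+ = begin
  pow ½ (suc k)            ≤⟨ pow-mono {½} {fromℕ 1} (suc k) (0≤/ 1 1) (*≤* (+≤+ (s≤s z≤n))) ⟩
  pow (fromℕ 1) (suc k)    ≡⟨ pow-fromℕ 1 (suc k) ⟩
  fromℕ (1 ℕ.^ suc k)      ≡⟨ cong fromℕ (ℕ.^-zeroˡ (suc k)) ⟩
  fromℕ 1                  ≤⟨ fromℕ-mono-≤ (ℕ.m^n>0 2 m) ⟩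
  fromℕ (2 ℕ.^ m)          ∎
  where open ℚ.≤-Reasoning

2^-lower : ∀ {z m} → + m ℤ.≤ z → fromℕ (2 ℕ.^ m) ℚ.≤ 2^ z
2^-lower {+ k} {m} (+≤+ m≤k) = ℚ.≤-trans (fromℕ-mono-≤ (ℕ.^-monoʳ-≤ 2 m≤k)) (ℚ.≤-reflexive (sym (pow-fromℕ 2 k)))

≤fromℕ⇒↥≤ : ∀ x m → x ℚ.≤ fromℕ m → ↥ x ℤ.≤ + (m ℕ.* ↧ₙ x)
≤fromℕ⇒↥≤ x@(mkℚ n d _) m x≤m = subst₂ ℤ._≤_ (ℤ.*-identityʳ n) (sym (ℤ.pos-* m (suc d)))
  (ℚᵘ.drop-*≤* (ℚᵘ.≤-respʳ-≃ (toℚᵘ-/ (+ m) 0) (ℚ.toℚᵘ-mono-≤ x≤m)))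

fromℕ≤⇒≤↥ : ∀ x m → fromℕ m ℚ.≤ x → + (m ℕ.* ↧ₙ x) ℤ.≤ ↥ x
fromℕ≤⇒≤↥ x@(mkℚ n d _) m m≤x = subst₂ ℤ._≤_ (sym (ℤ.pos-* m (suc d))) (ℤ.*-identityʳ n)
  (ℚᵘ.drop-*≤* (ℚᵘ.≤-respˡ-≃ (toℚᵘ-/ (+ m) 0) (ℚ.toℚᵘ-mono-≤ m≤x)))

-- Rational bounds on cuts, carried through the logarithm, product and quotient.

LowersBelow UppersAbove : Cut → ℚ → Set
LowersBelow x β = ∀ {q} → lower x q → q ℚ.≤ β
UppersAbove x α = ∀ {q} → upper x q → α ℚ.≤ q

-- If q = p / r exceeded `m`, then 2^p would be at least (2^m)^r, hence at least s^r for every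
-- positive s below x, contradicting the witness of q < log x.
log₂-lowers : ∀ {x m} → LowersBelow x (fromℕ (2 ℕ.^ m)) → LowersBelow (log₂ x) (fromℕ m)
log₂-lowers {x} {m} x≤ {q} (s , 0<s , s<x , 2^<) = ℚ.≮⇒≥ λ m<q → ℚ.<-irrefl refl (begin-strict
  2^ (↥ q)                        <⟨ 2^< ⟩
  pow s (↧ₙ q)                    ≤⟨ pow-mono (↧ₙ q) (ℚ.<⇒≤ 0<s) (x≤ s<x) ⟩
  pow (fromℕ (2 ℕ.^ m)) (↧ₙ q)    ≡⟨ pow-2^ m (↧ₙ q) ⟩
  fromℕ (2 ℕ.^ (m ℕ.* ↧ₙ q))      ≤⟨ 2^-lower (fromℕ≤⇒≤↥ q m (ℚ.<⇒≤ m<q)) ⟩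
  2^ (↥ q)                        ∎)
  where open ℚ.≤-Reasoning

log₂-uppers : ∀ {x m} → UppersAbove x (fromℕ (2 ℕ.^ m)) → UppersAbove (log₂ x) (fromℕ m)
log₂-uppers {x} {m} ≤x {q} (s , 0<s , x<s , <2^) = ℚ.≮⇒≥ λ q<m → ℚ.<-irrefl refl (begin-strict
  pow s (↧ₙ q)                    <⟨ <2^ ⟩
  2^ (↥ q)                        ≤⟨ 2^-upper (≤fromℕ⇒↥≤ q m (ℚ.<⇒≤ q<m)) ⟩
  fromℕ (2 ℕ.^ (m ℕ.* ↧ₙ q))      ≡⟨ pow-2^ m (↧ₙ q) ⟨
  pow (fromℕ (2 ℕ.^ m)) (↧ₙ q)    ≤⟨ pow-mono (↧ₙ q) (0≤fromℕ (2 ℕ.^ m)) (≤x x<s) ⟩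
  pow s (↧ₙ q)                    ∎)
  where open ℚ.≤-Reasoning

·-uppers : ∀ {x y α β} → 0ℚ ℚ.≤ α → 0ℚ ℚ.≤ β → UppersAbove x α → UppersAbove y β → UppersAbove (x · y) (α * β)
·-uppers {α = α} {β} 0≤α 0≤β α≤ β≤ {q} (a , b , c , d , _ , x<b , _ , y<d , max<q) = begin
  α * β                                                        ≤⟨ *-mono-≤-nonNeg 0≤α 0≤β (α≤ x<b) (β≤ y<d) ⟩
  b * d                                                        ≤⟨ ℚ.p≤q⊔p (b * c) (b * d) ⟩
  (b * c) ℚ.⊔ (b * d)                                          ≤⟨ ℚ.p≤q⊔p ((a * c) ℚ.⊔ (a * d)) _ ⟩
  ((a * c) ℚ.⊔ (a * d)) ℚ.⊔ ((b * c) ℚ.⊔ (b * d))              ≤⟨ ℚ.<⇒≤ max<q ⟩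
  q                                                            ∎
  where open ℚ.≤-Reasoning

-- The minimum of the corners is at most `a * c`, which suffices when `c` is nonnegative. Otherwise
-- the corner `b * c` is at most 0, because the upper bounds of `x` are nonnegative.
·-lowers : ∀ {x y α β} → 0ℚ ℚ.≤ α → 0ℚ ℚ.≤ β → UppersAbove x 0ℚ → LowersBelow x α → LowersBelow y β → LowersBelow (x · y) (α * β)
·-lowers {α = α} {β} 0≤α 0≤β 0≤x x≤α y≤β {q} (a , b , c , d , a<x , x<b , c<y , _ , q<min) with ℚ.≤-total 0ℚ c
... | inj₁ 0≤c = begin
  q                                                            ≤⟨ ℚ.<⇒≤ q<min ⟩
  ((a * c) ℚ.⊓ (a * d)) ℚ.⊓ ((b * c) ℚ.⊓ (b * d))              ≤⟨ ℚ.p⊓q≤p ((a * c) ℚ.⊓ (a * d)) _ ⟩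
  (a * c) ℚ.⊓ (a * d)                                          ≤⟨ ℚ.p⊓q≤p (a * c) (a * d) ⟩
  a * c                                                        ≤⟨ ℚ.*-monoʳ-≤-nonNeg c {{nonNegative 0≤c}} (x≤α a<x) ⟩
  α * c                                                        ≤⟨ ℚ.*-monoˡ-≤-nonNeg α {{nonNegative 0≤α}} (y≤β c<y) ⟩
  α * β                                                        ∎
  where open ℚ.≤-Reasoning
... | inj₂ c≤0 = begin
  q                                                            ≤⟨ ℚ.<⇒≤ q<min ⟩
  ((a * c) ℚ.⊓ (a * d)) ℚ.⊓ ((b * c) ℚ.⊓ (b * d))              ≤⟨ ℚ.p⊓q≤q ((a * c) ℚ.⊓ (a * d)) _ ⟩
  (b * c) ℚ.⊓ (b * d)                                          ≤⟨ ℚ.p⊓q≤p (b * c) (b * d) ⟩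
  b * c                                                        ≤⟨ ℚ.*-monoˡ-≤-nonNeg b {{nonNegative (0≤x x<b)}} c≤0 ⟩
  b * 0ℚ                                                       ≡⟨ ℚ.*-zeroʳ b ⟩
  0ℚ                                                           ≤⟨ *-nonNeg 0≤α 0≤β ⟩
  α * β                                                        ∎
  where open ℚ.≤-Reasoning

⁻¹-uppers : ∀ {y β} .{{β≢0 : ℚ.NonZero β}} → 0ℚ ℚ.< β → LowersBelow y β → UppersAbove (y ⁻¹) ((ℚ.1/ β) {{β≢0}})
⁻¹-uppers {y} {β} {{β≢0}} 0<β y≤β {q} (a , 0<a , a<y , 1<qa) = ℚ.*-cancelʳ-≤-pos β {{positive 0<β}} (begin
  (ℚ.1/ β) {{β≢0}} * β    ≡⟨ ℚ.*-inverseˡ β {{β≢0}} ⟩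
  1ℚ            ≤⟨ ℚ.<⇒≤ 1<qa ⟩
  q * a         ≤⟨ ℚ.*-monoˡ-≤-nonNeg q {{nonNegative (ℚ.<⇒≤ 0<q)}} (y≤β a<y) ⟩
  q * β         ∎)
  where
  open ℚ.≤-Reasoning
  0<q : 0ℚ ℚ.< q
  0<q = ℚ.*-cancelʳ-<-nonNeg a {{nonNegative (ℚ.<⇒≤ 0<a)}} (begin-strict
    0ℚ * a   ≡⟨ ℚ.*-zeroˡ a ⟩
    0ℚ       <⟨ 0<fromℕ 1 ⟩
    1ℚ       <⟨ 1<qa ⟩
    q * a    ∎)

-- The conclusion is cross-multiplied, so that the inverse of `β` stays inside this proof.
÷-uppers : ∀ {x y α β} → 0ℚ ℚ.≤ α → 0ℚ ℚ.< β → UppersAbove x α → LowersBelow y β →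
           ∀ {q} → upper (x ÷ y) q → α ℚ.≤ q * β
÷-uppers {x} {y} {α} {β} 0≤α 0<β α≤x y≤β {q} x÷y<q = begin
  α                    ≡⟨ ℚ.*-identityʳ α ⟨
  α * 1ℚ               ≡⟨ cong (α *_) (ℚ.*-inverseˡ β {{β≢0}}) ⟨
  α * (1/β * β)     ≡⟨ ℚ.*-assoc α 1/β β ⟨
  α * 1/β * β       ≤⟨ ℚ.*-monoʳ-≤-nonNeg β {{nonNegative (ℚ.<⇒≤ 0<β)}}
                            (·-uppers {x} {y ⁻¹} 0≤α (ℚ.<⇒≤ (ℚ.positive⁻¹ 1/β {{ℚ.1/pos⇒pos β {{positive 0<β}}}})) α≤x (⁻¹-uppers {y} {{β≢0}} 0<β y≤β) x÷y<q) ⟩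
  q * β                ∎
  where
  open ℚ.≤-Reasoning
  β≢0 : ℚ.NonZero β
  β≢0 = ℚ.>-nonZero 0<β
  1/β : ℚ
  1/β = (ℚ.1/ β) {{β≢0}}

-- The error term and its limit.

ℓ₁ ℓ₂ ℓ₃ : ℕ → ℕ
ℓ₁ n = ⌊log₂ n ⌋
ℓ₂ n = ⌊log₂ ℓ₁ n ⌋
ℓ₃ n = ⌊log₂ ℓ₂ n ⌋

-- Below the range of the asymptotic estimate, the error is chosen so large
-- that the bound exceeds 1.

δ-numerator δ-denominator-1 : ℕ → ℕ
δ-numerator n     = if does (8 ℕ.≤? ℓ₃ n) then 20 else n ℕ.* suc (ℓ₂ n)
δ-denominator-1 n = if does (8 ℕ.≤? ℓ₃ n) then ℓ₃ n else 0

δ : ℕ → ℚ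
δ n = + δ-numerator n / suc (δ-denominator-1 n)

δ-eventually : ∀ {n} → 8 ≤ ℓ₃ n → δ n ≡ + 20 / suc (ℓ₃ n)
δ-eventually {n} 8≤ = cong₂ (λ x y → + x / suc y)
  (cong (λ large → if large then 20 else n ℕ.* suc (ℓ₂ n)) (dec-true (8 ℕ.≤? ℓ₃ n) 8≤))
  (cong (λ large → if large then ℓ₃ n else 0) (dec-true (8 ℕ.≤? ℓ₃ n) 8≤))

ℓ₃-unbounded : ∀ m → ∃[ N ] ∀ n → N ≤ n → m ≤ ℓ₃ n
ℓ₃-unbounded m = 2 ℕ.^ (2 ℕ.^ (2 ℕ.^ m)) , λ n N≤n →
  2^≤⇒≤⌊log₂⌋ {m} {ℓ₂ n} (2^≤⇒≤⌊log₂⌋ {2 ℕ.^ m} {ℓ₁ n} (2^≤⇒≤⌊log₂⌋ {2 ℕ.^ (2 ℕ.^ m)} {n} N≤n))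

20/-small : ∀ p d .(c : Coprime (suc p) (suc d)) m → 20 ℕ.* suc d ≤ m → + 20 / suc m ℚ.< mkℚ (+ suc p) d c
20/-small p d c m 20d≤m = ℚ.toℚᵘ-cancel-< (ℚᵘ.<-respˡ-≃ (ℚᵘ.≃-sym (toℚᵘ-/ (+ 20) m)) (ℚᵘ.*<* (ℤ.+<+
  (ℕ.<-≤-trans (s≤s 20d≤m) (ℕ.m≤n*m (suc m) (suc p))))))

δ-tendsToZero : TendsToZero δ
δ-tendsToZero (mkℚ -[1+ _ ] _ _) (*<* ())
δ-tendsToZero (mkℚ (+ zero) _ _) (*<* (ℤ.+<+ ()))
δ-tendsToZero ε@(mkℚ (+ suc p) d c) 0<ε =
  -- The summand 8 reaches the range where δ is 20 / (ℓ₃ n + 1); `20 * suc d` then pushes this below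
  -- 1 / (d + 1), which is at most ε.
  map₂ (λ N≤⇒ n N≤n → small {n} (N≤⇒ n N≤n)) (ℓ₃-unbounded (8 ℕ.+ 20 ℕ.* suc d))
  where
  small : ∀ {n} → 8 ℕ.+ 20 ℕ.* suc d ≤ ℓ₃ n → ℚ.∣ δ n ∣ ℚ.< ε
  small {n} M≤ℓ₃ = subst (ℚ._< ε)
    (sym (trans (cong ℚ.∣_∣ (δ-eventually {n} (ℕ.m+n≤o⇒m≤o 8 M≤ℓ₃))) (ℚ.0≤p⇒∣p∣≡p (0≤/ 20 (ℓ₃ n)))))
    (20/-small p d c (ℓ₃ n) (ℕ.m+n≤o⇒n≤o 8 M≤ℓ₃))

-- The bound for each `n`, first in integers and then for cuts.

module _ {n : ℕ} .{{_ : NonZero n}} (3≤n : 3 ≤ n) where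

  private
    1≤ℓ₁ : 1 ≤ ℓ₁ n
    1≤ℓ₁ = 2^≤⇒≤⌊log₂⌋ {1} (ℕ.≤-trans (ℕ.n≤1+n 2) 3≤n)

    ℓ₁-nonZero : NonZero (ℓ₁ n)
    ℓ₁-nonZero = ℕ.>-nonZero 1≤ℓ₁

  module _ (S : Strategy n) where

    private
      F O b d : ℕ
      F = length (filter (bobSucceeds? S) (Outcomes n))
      O = length (Outcomes n)
      b = ℓ₂ n
      d = ℓ₃ n

      -- This is F / O ≤ (4 + x / (y + 1)) ℓ₁ n / (n (b + 1)) with denominators cleared. Rounding
      -- log n down and log log n up only lowers the right side.
      Bound : ℕ → ℕ → Set
      Bound x y = F ℕ.* (n ℕ.* suc b) ℕ.* suc y ≤ (4 ℕ.* suc y ℕ.+ x) ℕ.* ℓ₁ n ℕ.* O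

    -- The fallback error equals the cleared denominator `n * suc b`, and `ℓ₁ n` is at least 1, so
    -- the right side is at least 1 as a probability and F ≤ O suffices.
    successes-bound-small : Bound (n ℕ.* suc b) 0
    successes-bound-small = begin
      F ℕ.* (n ℕ.* suc b) ℕ.* 1           ≡⟨ ℕ.*-identityʳ (F ℕ.* (n ℕ.* suc b)) ⟩
      F ℕ.* (n ℕ.* suc b)                 ≤⟨ ℕ.*-monoˡ-≤ (n ℕ.* suc b) (length-filter (bobSucceeds? S) (Outcomes n)) ⟩
      O ℕ.* (n ℕ.* suc b)                 ≡⟨ ℕ.*-comm O (n ℕ.* suc b) ⟩
      n ℕ.* suc b ℕ.* O                   ≤⟨ ℕ.*-monoˡ-≤ O (ℕ.≤-trans (ℕ.m≤n+m (n ℕ.* suc b) 4) (ℕ.m≤m*n (4 ℕ.+ n ℕ.* suc b) (ℓ₁ n) {{ℓ₁-nonZero}})) ⟩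
      (4 ℕ.+ n ℕ.* suc b) ℕ.* ℓ₁ n ℕ.* O  ∎
      where open ℕ.≤-Reasoning

    successes-bound-large : 8 ≤ d → Bound 20 d
    successes-bound-large 8≤d = conclude (threshold {n} {ℓ₁ n} {b} {d} (2^⌊log₂n⌋≤n n) (n<2^[1+⌊log₂n⌋] n)
      (2^⌊log₂n⌋≤n (ℓ₁ n) {{ℓ₁-nonZero}}) (2^⌊log₂n⌋≤n b {{b-nonZero}}) (n<2^[1+⌊log₂n⌋] b) 8≤d)
      where
      b-nonZero : NonZero b
      b-nonZero = ℕ.≢-nonZero λ b≡0 → contradiction (subst (λ m → 8 ≤ ⌊log₂ m ⌋) b≡0 8≤d) λ ()
      open ℕ.≤-Reasoning
      rearrange : ∀ F n b d → F ℕ.* (n ℕ.* (1 ℕ.+ b)) ℕ.* (1 ℕ.+ d) ≡ F ℕ.* n ℕ.* ((b ℕ.+ 1) ℕ.* (d ℕ.+ 1))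
      rearrange = solve-∀
      collect : ∀ K O x y → K ℕ.* O ℕ.* (x ℕ.* y) ≡ K ℕ.* x ℕ.* y ℕ.* O
      collect = solve-∀
      conclude : ∃[ k ] 4 ℕ.* suc k ≤ n × n ℕ.* n ℕ.* 4 ℕ.^ suc k ≤ suc k ℕ.! ×
                   2 ℕ.* suc k ℕ.* (b ℕ.+ 1) ℕ.* (d ℕ.+ 1) ≤ (4 ℕ.* (d ℕ.+ 1) ℕ.+ 20) ℕ.* ℓ₁ n →
                 Bound 20 d
      conclude (k , 4K≤n , factorial-large , K-small) = begin
        F ℕ.* (n ℕ.* suc b) ℕ.* suc d                      ≡⟨ rearrange F n b d ⟩
        F ℕ.* n ℕ.* ((b ℕ.+ 1) ℕ.* (d ℕ.+ 1))              ≤⟨ ℕ.*-monoˡ-≤ ((b ℕ.+ 1) ℕ.* (d ℕ.+ 1)) (successes-bound S k 4K≤n factorial-large) ⟩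
        2 ℕ.* suc k ℕ.* O ℕ.* ((b ℕ.+ 1) ℕ.* (d ℕ.+ 1))    ≡⟨ collect (2 ℕ.* suc k) O (b ℕ.+ 1) (d ℕ.+ 1) ⟩
        2 ℕ.* suc k ℕ.* (b ℕ.+ 1) ℕ.* (d ℕ.+ 1) ℕ.* O      ≤⟨ ℕ.*-monoˡ-≤ O K-small ⟩
        (4 ℕ.* (d ℕ.+ 1) ℕ.+ 20) ℕ.* ℓ₁ n ℕ.* O            ≡⟨ cong (λ z → (4 ℕ.* z ℕ.+ 20) ℕ.* ℓ₁ n ℕ.* O) (ℕ.+-comm d 1) ⟩
        (4 ℕ.* suc d ℕ.+ 20) ℕ.* ℓ₁ n ℕ.* O                ∎

    successes-bound-δ : Bound (δ-numerator n) (δ-denominator-1 n)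
    successes-bound-δ = by-cases (8 ℕ.≤? d)
      where
      -- With the decision as an argument, one match reduces the conditionals of numerator and
      -- denominator together.
      by-cases : (large? : Dec (8 ≤ d)) →
                 Bound (if does large? then 20 else n ℕ.* suc b) (if does large? then d else 0)
      by-cases (yes 8≤d) = successes-bound-large 8≤d
      by-cases (no _)    = successes-bound-small

  private
    N : Cut
    N = real (fromℕ n)

  log₂N-lowers : LowersBelow (log₂ N) (fromℕ (suc (ℓ₁ n)))
  log₂N-lowers = log₂-lowers {N} {suc (ℓ₁ n)} λ q<n →
    ℚ.≤-trans (ℚ.<⇒≤ q<n) (fromℕ-mono-≤ {n} {2 ℕ.^ suc (ℓ₁ n)} (ℕ.<⇒≤ (n<2^[1+⌊log₂n⌋] n)))

  log₂N-uppers : UppersAbove (log₂ N) (fromℕ (ℓ₁ n))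
  log₂N-uppers = log₂-uppers {N} {ℓ₁ n} λ n<q →
    ℚ.≤-trans (fromℕ-mono-≤ {2 ℕ.^ ℓ₁ n} {n} (2^⌊log₂n⌋≤n n)) (ℚ.<⇒≤ n<q)

  -- Rounding up twice loses nothing extra: between integers, `ℓ₁ n < 2 ^ suc (ℓ₂ n)` already means
  -- `suc (ℓ₁ n) ≤ 2 ^ suc (ℓ₂ n)`.
  log₂log₂N-lowers : LowersBelow (log₂ (log₂ N)) (fromℕ (suc (ℓ₂ n)))
  log₂log₂N-lowers = log₂-lowers {log₂ N} {suc (ℓ₂ n)} λ q<log →
    ℚ.≤-trans (log₂N-lowers q<log) (fromℕ-mono-≤ {suc (ℓ₁ n)} {2 ℕ.^ suc (ℓ₂ n)} (n<2^[1+⌊log₂n⌋] (ℓ₁ n)))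

  -- Since `_≤ᴿ_` is a negation, a rational `q` above the bound and below the probability has to be
  -- refuted. Multiplication by `β`, an upper bound for n log log n, reduces this to
  -- `successes-bound-δ`.
  success-≤ : (S : Strategy n) → real (successProbability S) ≤ᴿ (real (fromℕ 4 + δ n) · log₂ N) ÷ (N · log₂ (log₂ N))
  success-≤ S (q , bound<q , q<p) = ℚ.<-irrefl refl (ℚ.<-≤-trans q<p (ℚ.*-cancelʳ-≤-pos β {{positive 0<β}} (begin
    successProbability S * β      ≡⟨ cong (successProbability S *_) (fromℕ-* n (suc (ℓ₂ n))) ⟨
    successProbability S * fromℕ (n ℕ.* suc (ℓ₂ n))
      ≤⟨ fraction-bound (length (filter (bobSucceeds? S) (Outcomes n))) (length (Outcomes n))
           (n ℕ.* suc (ℓ₂ n)) (δ-numerator n) (δ-denominator-1 n) (ℓ₁ n) (successes-bound-δ S) ⟩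
    (fromℕ 4 + δ n) * fromℕ (ℓ₁ n)
      ≤⟨ ÷-uppers {real (fromℕ 4 + δ n) · log₂ N} {N · log₂ (log₂ N)} {(fromℕ 4 + δ n) * fromℕ (ℓ₁ n)} {β} (*-nonNeg 0≤4+δ (0≤fromℕ (ℓ₁ n))) 0<β
           (·-uppers {real (fromℕ 4 + δ n)} {log₂ N} {fromℕ 4 + δ n} {fromℕ (ℓ₁ n)} 0≤4+δ (0≤fromℕ (ℓ₁ n)) ℚ.<⇒≤ log₂N-uppers)
           (·-lowers {N} {log₂ (log₂ N)} {fromℕ n} {fromℕ (suc (ℓ₂ n))} (0≤fromℕ n) (0≤fromℕ (suc (ℓ₂ n)))
             (λ n<b → ℚ.≤-trans (0≤fromℕ n) (ℚ.<⇒≤ n<b)) ℚ.<⇒≤ log₂log₂N-lowers)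
           bound<q ⟩
    q * β                         ∎)))
    where
    open ℚ.≤-Reasoning
    β : ℚ
    β = fromℕ n * fromℕ (suc (ℓ₂ n))
    0<β : 0ℚ ℚ.< β
    0<β = subst (0ℚ ℚ.<_) (fromℕ-* n (suc (ℓ₂ n))) (0<fromℕ (n ℕ.* suc (ℓ₂ n)) {{ℕ.m*n≢0 n (suc (ℓ₂ n))}})
    0≤4+δ : 0ℚ ℚ.≤ fromℕ 4 + δ n
    0≤4+δ = ℚ.+-mono-≤ (0≤fromℕ 4) (0≤/ (δ-numerator n) (δ-denominator-1 n))

theorem20 : Σ[ δ ∈ (ℕ → ℚ) ] TendsToZero δ ×
    (∀ n .{{_ : NonZero n}} → 3 ≤ n → (S : Strategy n) →
    let N = real (fromℕ n) in
    real (successProbability S)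
    ≤ᴿ (real (fromℕ 4 + δ n) · log₂ N) ÷ (N · log₂ (log₂ N)))
theorem20 = δ , δ-tendsToZero , λ n 3≤n S → success-≤ 3≤n S
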